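{- Every cactus is in $B_1^m$.
   Context: A cactus is a connected graph in which any two simple cycles have at most one vertex in common. An EPG representation of a graph is a set of paths on a rectangular grid (sequences of grid points joined consecutively by grid edges), one per vertex, such that two vertices are adjacent iff their paths share a grid edge. A bend is a point of a path where a horizontal and a vertical grid edge of the path meet; a path is monotonic if it is ascending in both columns and rows. $B_1^m$ is the class of graphs having an EPG representation in which every path is monotonic and has at most one bend. -}

module Defs where

open import Data.Fin.Base using (Fin)
open import Data.List.Base using (List; []; _∷_; _++_; [_]; length)
open import Data.List.Membership.Propositional using (_∈_)
open import Data.List.NonEmpty.Base using (List⁺; toList)
open import Data.List.Relation.Unary.All using (All)
open import Data.List.Relation.Unary.Linked using (Linked)
open import Data.List.Relation.Unary.Unique.Propositional using (Unique)
open import Data.Nat.Base using (ℕ; suc; _≤_; _<_)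
open import Data.Product.Base using (Σ-syntax; ∃-syntax; _×_; _,_; proj₁; proj₂)
open import Data.Sum.Base using (_⊎_)
open import Function.Bundles using (_⇔_)
open import Level using (0ℓ)
open import Relation.Binary.Core using (Rel)
open import Relation.Binary.Construct.Closure.ReflexiveTransitive using (Star)
open import Relation.Binary.Definitions using (Decidable; Irreflexive; Symmetric)
open import Relation.Binary.PropositionalEquality.Core using (_≡_; _≢_)
open import Relation.Nullary.Negation.Core using (¬_)

steps : ∀ {A : Set} → List A → List (A × A)
steps []           = []
steps (_ ∷ [])     = []
steps (x ∷ y ∷ xs) = (x , y) ∷ steps (y ∷ xs)

-- {x , y} is an undirected edge traversed by the sequence xs.
Traverses : ∀ {A : Set} → List A → Rel A 0ℓ
Traverses xs x y = (x , y) ∈ steps xs ⊎ (y , x) ∈ steps xs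

record Graph (n : ℕ) : Set₁ where
  field
    Adj    : Rel (Fin n) 0ℓ
    adj?   : Decidable Adj
    sym    : Symmetric Adj
    irrefl : Irreflexive _≡_ Adj

module _ {n : ℕ} (G : Graph n) where
  open Graph G

  Connected : Set
  Connected = ∀ u v → Star Adj u v

  -- The vertices are listed once each; the closing edge from the last one
  -- back to the first is added by `closed`.
  record SimpleCycle : Set where
    field
      first    : Fin n
      rest     : List (Fin n)

    vertices : List (Fin n)
    vertices = first ∷ rest

    closed : List (Fin n)
    closed = vertices ++ [ first ]

    field
      distinct : Unique vertices
      long     : 3 ≤ length vertices
      adjacent : Linked Adj closed

  open SimpleCycle

  -- Cycles are identified when they are the same subgraph, i.e. regardless
  -- of starting vertex and orientation.
  SameCycle : Rel SimpleCycle 0ℓ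
  SameCycle C D = ∀ u v → Traverses (closed C) u v ⇔ Traverses (closed D) u v

  ShareAtMostOneVertex : Rel SimpleCycle 0ℓ
  ShareAtMostOneVertex C D = ∀ {u v} →
    u ∈ vertices C → u ∈ vertices D →
    v ∈ vertices C → v ∈ vertices D → u ≡ v

  IsCactus : Set
  IsCactus = Connected × (∀ C D → ¬ SameCycle C D → ShareAtMostOneVertex C D)

-- (column , row)
Point : Set
Point = ℕ × ℕ

col row : Point → ℕ
col = proj₁
row = proj₂

Consecutive : Rel ℕ 0ℓ
Consecutive a b = b ≡ suc a ⊎ a ≡ suc b

Horizontal Vertical GridEdge : Rel Point 0ℓ
Horizontal p q = row p ≡ row q × Consecutive (col p) (col q)
Vertical   p q = col p ≡ col q × Consecutive (row p) (row q)
GridEdge   p q = Horizontal p q ⊎ Vertical p q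

record GridPath (cols rows : ℕ) : Set where
  field
    points⁺ : List⁺ Point

  points : List Point
  points = toList points⁺

  field
    inGrid  : All (λ p → col p < cols × row p < rows) points
    linked  : Linked GridEdge points

open GridPath using (points)

module _ {cols rows : ℕ} where

  EdgeOf : GridPath cols rows → Rel Point 0ℓ
  EdgeOf P = Traverses (points P)

  ShareEdge : Rel (GridPath cols rows) 0ℓ
  ShareEdge P Q = ∃[ p ] ∃[ q ] EdgeOf P p q × EdgeOf Q p q

  IsBend : GridPath cols rows → Point → Set
  IsBend P p =
    (∃[ q ] EdgeOf P p q × Horizontal p q) ×
    (∃[ r ] EdgeOf P p r × Vertical p r)

  AtMostOneBend : GridPath cols rows → Set
  AtMostOneBend P = ∀ {p q} → IsBend P p → IsBend P q → p ≡ q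

  Monotonic : GridPath cols rows → Set
  Monotonic P = Linked (λ p q → col p ≤ col q × row p ≤ row q) (points P)

record EPGRepresentation {n : ℕ} (G : Graph n) : Set where
  open Graph G
  field
    cols rows : ℕ
    path      : Fin n → GridPath cols rows
    adj⇔share : ∀ {u v} → u ≢ v → Adj u v ⇔ ShareEdge (path u) (path v)

B₁ᵐ : ∀ {n} → Graph n → Set
B₁ᵐ G = Σ[ R ∈ EPGRepresentation G ]
  (∀ v → Monotonic (EPGRepresentation.path R v) ×
         AtMostOneBend (EPGRepresentation.path R v))

{-# OPTIONS --safe #-}

-- Grow a set S of represented vertices, keeping two invariants: every vertex of S
-- has a grid edge covered by its path alone, and the walks through a component
-- outside S attach to a single vertex of S.  Let v in S be adjacent to w outside S.
-- If some walk outside S leads from w to another neighbour of v, then it closes, through v,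
-- to a cycle, which by the cactus property has neither chords nor ears: add that
-- cycle.  Otherwise add w as a pendant vertex.  In both cases the new vertices form
-- a path whose ends, and nothing else, are adjacent to S, and only to v; after
-- refining the grid they are drawn around the private edge of v.

module Submission where

open import Defs
open import Data.Empty using (⊥; ⊥-elim)
open import Data.Fin.Base using (Fin; zero; suc; toℕ; fromℕ)
open import Data.Fin.Properties using (toℕ<n; toℕ-injective; toℕ-fromℕ; injective⇒≤) renaming (_≟_ to _≟ᶠ_; all? to allᶠ?; any? to anyᶠ?)
open import Data.List.Base using (List; []; _∷_; _++_; [_]; map; length; lookup)
open import Data.List.Membership.DecPropositional using () renaming (_∈?_ to member?)
open import Data.List.Membership.Propositional using (_∈_; _∉_; find; lose)
open import Data.List.Membership.Propositional.Properties using (∈-++⁺ˡ; ∈-++⁺ʳ; ∈-++⁻; ∈-map⁺; ∈-map⁻; ∈-lookup; ∈-∃++)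
open import Data.List.NonEmpty.Base using () renaming (_∷_ to _∷⁺_)
open import Data.List.Properties using (++-assoc; ++-identityʳ; length-++)
open import Data.List.Relation.Unary.All as All using (All; []; _∷_)
open import Data.List.Relation.Unary.All.Properties using (++⁻ˡ; ¬Any⇒All¬)
open import Data.List.Relation.Unary.AllPairs using ([]; _∷_)
open import Data.List.Relation.Unary.Any using (Any; here; there; any?; index)
open import Data.List.Relation.Unary.Any.Properties using (lookup-index)
open import Data.List.Relation.Unary.Linked as Linked using (Linked; [-]; _∷_)
open import Data.List.Relation.Unary.Unique.Propositional using (Unique)
import Data.List.Relation.Unary.Unique.Propositional.Properties as Unique
open import Data.Nat.Base using (ℕ; zero; suc; _+_; _*_; _∸_; _≤_; _<_; _⊔_; z≤n; s≤s; s≤s⁻¹; z<s)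
open import Data.Nat.DivMod using (_/_; _%_; m≡m%n+[m/n]*n; m%n<n; [m+kn]%n≡m%n; m<n⇒m%n≡m; m<n*o⇒m/o<n; /-monoˡ-≤; m*n/n≡m)
open import Data.Nat.Properties using (≤-refl; ≤-trans; ≤-antisym; ≤-reflexive; <-irrefl; <⇒≤; n≤1+n; 1+n≰n; 1+n≢n; m≤m+n; m≤n+m; m≤m⊔n; m≤n⊔m; m≤n⇒m<n∨m≡n; suc-injective; +-suc; +-identityʳ; +-monoˡ-≤; +-monoʳ-≤; +-monoˡ-<; +-cancelˡ-≡; +-cancelʳ-≡; +-cancelʳ-≤; +-cancelʳ-<; *-cancelʳ-≡; *-monoˡ-≤; m+[n∸m]≡n; m∸n+n≡m) renaming (_≟_ to _≟ⁿ_; _≤?_ to _≤ⁿ?_; _<?_ to _<ⁿ?_)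
open import Data.Product.Base using (∃-syntax; _×_; _,_; proj₁; proj₂)
open import Data.Product.Properties using (,-injectiveˡ) renaming (≡-dec to ×-≡-dec)
open import Data.Sum.Base using (_⊎_; inj₁; inj₂; swap)
open import Function.Base using (_∘_)
open import Function.Bundles using (_⇔_; mk⇔; Equivalence)
open import Function.Definitions using (Injective)
open import Level using (0ℓ)
open import Relation.Binary.Core using (Rel; _⇒_)
open import Relation.Binary.Construct.Closure.ReflexiveTransitive as Star using (Star; ε; _◅_; _◅◅_)
open import Relation.Binary.Definitions using (Decidable; DecidableEquality; Symmetric)
open import Relation.Binary.PropositionalEquality using (_≡_; _≢_; refl; sym; trans; cong; cong₂; subst)
open import Relation.Nullary.Decidable using (Dec; yes; no; True; toWitness; map′; decidable-stable; _×-dec_; _⊎-dec_; _→-dec_; ¬?)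
open import Relation.Nullary.Negation using (¬_)

open Equivalence using (to; from)

-- Private edges are renewable: refinement turns one into N collinear edges, a drawing around it
-- uses some of them, and one left over remains private to the host. Every new path also gets an
-- edge on a line that no old path uses, so any represented vertex can host arbitrarily many later
-- additions. The attachment invariant stands in for a decomposition into blocks: it alone
-- guarantees that new vertices see no vertex of S other than v. The bend budget dictates the
-- drawings. With at least four new vertices, the two ends spend their bend on leaving the host
-- upwards, and their neighbours spend theirs on passing between the columns of the ends and a
-- common row; all others stay straight. With three new vertices the single middle path would need
-- both of these turns. There the ends meet the host from opposite sides of one column, so that one
-- vertical leg reaches both; this is the only drawing that uses points below the host.

-- Unit edges and monotonic paths with at most one bend

data Direction : Set where
  hor ver : Direction

opposite : Direction → Direction
opposite hor = ver
opposite ver = hor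

-- (o , s , t) is the unit edge from s to s + 1 on the t-th line of direction o.
Edge : Set
Edge = Direction × ℕ × ℕ

at : Direction → ℕ → ℕ → Point
at hor s t = s , t
at ver s t = t , s

src tgt : Edge → Point
src (o , s , t) = at o s t
tgt (o , s , t) = at o (suc s) t

-- For bent o a b c d the first leg runs in direction o on line b from a to c,
-- the second in the opposite direction on line c from b to d.
record LPath : Set where
  constructor bent
  field
    dir     : Direction
    a b c d : ℕ
    a≤c     : a ≤ c
    b≤d     : b ≤ d

data Covers : LPath → Edge → Set where
  leg₁ : ∀ {o a b c d p q s} → a ≤ s → s < c → Covers (bent o a b c d p q) (o , s , b)
  leg₂ : ∀ {o a b c d p q s} → b ≤ s → s < d → Covers (bent o a b c d p q) (opposite o , s , c)

Share : LPath → LPath → Set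
Share P Q = ∃[ e ] Covers P e × Covers Q e

segment : Direction → ℕ → ℕ → ℕ → List Edge
segment o t s zero    = []
segment o t s (suc m) = (o , s , t) ∷ segment o t (suc s) m

-- `Covers` suits symbolic coordinates; the list, ordered from start to end, yields the points of a
-- grid path and permits checking by evaluation.
edges : LPath → List Edge
edges (bent o a b c d _ _) = segment o b a (c ∸ a) ++ segment (opposite o) c b (d ∸ b)

∈-segment⁺ : ∀ {o t s i} m → s ≤ i → i < s + m → (o , i , t) ∈ segment o t s m
∈-segment⁺ {s = s} zero s≤i i<s rewrite +-identityʳ s = ⊥-elim (1+n≰n (≤-trans i<s s≤i))
∈-segment⁺ {s = s} {i} (suc m) s≤i i<s with m≤n⇒m<n∨m≡n s≤i
... | inj₁ s<i  = there (∈-segment⁺ m s<i (subst (i <_) (+-suc s m) i<s))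
... | inj₂ refl = here refl

∈-segment⁻ : ∀ {o t s e} m → e ∈ segment o t s m → ∃[ i ] s ≤ i × i < s + m × e ≡ (o , i , t)
∈-segment⁻ {s = s} (suc m) (here refl) = s , ≤-refl , subst (s <_) (sym (+-suc s m)) (s≤s (m≤m+n s m)) , refl
∈-segment⁻ {s = s} (suc m) (there e∈) with ∈-segment⁻ m e∈
... | i , s<i , i< , eq = i , <⇒≤ s<i , subst (i <_) (sym (+-suc s m)) i< , eq

covers⇒∈edges : ∀ {P e} → Covers P e → e ∈ edges P
covers⇒∈edges {bent o a b c d a≤c b≤d} (leg₁ p q) =
  ∈-++⁺ˡ (∈-segment⁺ (c ∸ a) p (subst (_ <_) (sym (m+[n∸m]≡n a≤c)) q))
covers⇒∈edges {bent o a b c d a≤c b≤d} (leg₂ p q) =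
  ∈-++⁺ʳ (segment o b a (c ∸ a)) (∈-segment⁺ (d ∸ b) p (subst (_ <_) (sym (m+[n∸m]≡n b≤d)) q))

∈edges⇒covers : ∀ {P e} → e ∈ edges P → Covers P e
∈edges⇒covers {bent o a b c d a≤c b≤d} e∈ with ∈-++⁻ (segment o b a (c ∸ a)) e∈
... | inj₁ e∈₁ with _ , p , q , refl ← ∈-segment⁻ (c ∸ a) e∈₁ = leg₁ p (subst (_ <_) (m+[n∸m]≡n a≤c) q)
... | inj₂ e∈₂ with _ , p , q , refl ← ∈-segment⁻ (d ∸ b) e∈₂ = leg₂ p (subst (_ <_) (m+[n∸m]≡n b≤d) q)

-- Realisation as grid paths

data Chain : Point → List Edge → Set where
  []  : ∀ {p} → Chain p []
  _∷_ : ∀ {p e es} → src e ≡ p → Chain (tgt e) es → Chain p (e ∷ es)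

chain-segment : ∀ o t s m {es} → Chain (at o (s + m) t) es → Chain (at o s t) (segment o t s m ++ es)
chain-segment o t s zero    c rewrite +-identityʳ s = c
chain-segment o t s (suc m) c rewrite +-suc s m     = refl ∷ chain-segment o t (suc s) m c

at-opposite : ∀ o s t → at (opposite o) s t ≡ at o t s
at-opposite hor s t = refl
at-opposite ver s t = refl

start : LPath → Point
start (bent o a b _ _ _ _) = at o a b

chain-edges : ∀ P → Chain (start P) (edges P)
chain-edges (bent o a b c d a≤c b≤d) = chain-segment o b a (c ∸ a)
  (subst (λ p → Chain p _) (trans (at-opposite o b c) (cong (λ x → at o x b) (sym (m+[n∸m]≡n a≤c))))
    (subst (Chain _) (++-identityʳ _) (chain-segment (opposite o) c b (d ∸ b) [])))

steps-chain : ∀ {p es} → Chain p es → steps (p ∷ map tgt es) ≡ map (λ e → src e , tgt e) es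
steps-chain []         = refl
steps-chain (refl ∷ c) = cong (_ ∷_) (steps-chain c)

linked-chain : ∀ {ℓ} {R : Point → Point → Set ℓ} → (∀ e → R (src e) (tgt e)) →
  ∀ {p es} → Chain p es → Linked R (p ∷ map tgt es)
linked-chain r []         = [-]
linked-chain r (refl ∷ c) = r _ ∷ linked-chain r c

-- As `a ≤ c` and `b ≤ d`, the sum bounds all coordinates, whichever axis the first leg follows.
extent : LPath → ℕ
extent (bent _ _ _ c d _ _) = c + d

at-bounded : ∀ o {s t B} → s ≤ B → t ≤ B → col (at o s t) < suc B × row (at o s t) < suc B
at-bounded hor p q = s≤s p , s≤s q
at-bounded ver p q = s≤s q , s≤s p

start-bounded : ∀ P {B} → extent P ≤ B → col (start P) < suc B × row (start P) < suc B
start-bounded (bent o a b c d a≤c b≤d) le = at-bounded o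
  (≤-trans (≤-trans a≤c (m≤m+n c d)) le) (≤-trans (≤-trans b≤d (m≤n+m d c)) le)

tgt-bounded : ∀ {P e B} → extent P ≤ B → Covers P e → col (tgt e) < suc B × row (tgt e) < suc B
tgt-bounded {bent o a b c d a≤c b≤d} le (leg₁ _ q) = at-bounded o
  (≤-trans (≤-trans q (m≤m+n c d)) le) (≤-trans (≤-trans b≤d (m≤n+m d c)) le)
tgt-bounded {bent o a b c d a≤c b≤d} le (leg₂ _ q) = at-bounded (opposite o)
  (≤-trans (≤-trans q (m≤n+m d c)) le) (≤-trans (m≤m+n c d) le)

gridEdge : ∀ e → GridEdge (src e) (tgt e)
gridEdge (hor , s , t) = inj₁ (refl , inj₁ refl)
gridEdge (ver , s , t) = inj₂ (refl , inj₁ refl)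

ascending : ∀ e → col (src e) ≤ col (tgt e) × row (src e) ≤ row (tgt e)
ascending (hor , s , t) = n≤1+n s , ≤-refl
ascending (ver , s , t) = ≤-refl , n≤1+n s

realise : ∀ P {B} → extent P ≤ B → GridPath (suc B) (suc B)
realise P le = record
  { points⁺ = start P ∷⁺ map tgt (edges P)
  ; inGrid  = start-bounded P le ∷ All.tabulate inBounds
  ; linked  = linked-chain gridEdge (chain-edges P)
  }
  where
  inBounds : ∀ {p} → p ∈ map tgt (edges P) → col p < _ × row p < _
  inBounds p∈ with e , e∈ , refl ← ∈-map⁻ tgt p∈ = tgt-bounded {P} le (∈edges⇒covers e∈)

realise-monotonic : ∀ P {B} (le : extent P ≤ B) → Monotonic (realise P le)
realise-monotonic P le = linked-chain ascending (chain-edges P)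

module _ (P : LPath) {B : ℕ} (le : extent P ≤ B) where

  step⁺ : ∀ {e} → Covers P e → (src e , tgt e) ∈ steps (GridPath.points (realise P le))
  step⁺ c = subst (_ ∈_) (sym (steps-chain (chain-edges P))) (∈-map⁺ _ (covers⇒∈edges c))

  step⁻ : ∀ {p q} → (p , q) ∈ steps (GridPath.points (realise P le)) →
    ∃[ e ] Covers P e × p ≡ src e × q ≡ tgt e
  step⁻ s with e , e∈ , refl ← ∈-map⁻ _ (subst (_ ∈_) (steps-chain (chain-edges P)) s) =
    e , ∈edges⇒covers e∈ , refl , refl

  horizontal⇒covers : ∀ {p q} → EdgeOf (realise P le) p q → Horizontal p q → ∃[ s ] Covers P (hor , s , row p)
  horizontal⇒covers (inj₁ s) h with step⁻ s
  horizontal⇒covers (inj₁ s) h       | (hor , i , t) , c , refl , refl = i , c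
  horizontal⇒covers (inj₁ s) (h , _) | (ver , i , t) , c , refl , refl = ⊥-elim (1+n≢n (sym h))
  horizontal⇒covers (inj₂ s) h with step⁻ s
  horizontal⇒covers (inj₂ s) h       | (hor , i , t) , c , refl , refl = i , c
  horizontal⇒covers (inj₂ s) (h , _) | (ver , i , t) , c , refl , refl = ⊥-elim (1+n≢n h)

  vertical⇒covers : ∀ {p q} → EdgeOf (realise P le) p q → Vertical p q → ∃[ s ] Covers P (ver , s , col p)
  vertical⇒covers (inj₁ s) h with step⁻ s
  vertical⇒covers (inj₁ s) h       | (ver , i , t) , c , refl , refl = i , c
  vertical⇒covers (inj₁ s) (h , _) | (hor , i , t) , c , refl , refl = ⊥-elim (1+n≢n (sym h))
  vertical⇒covers (inj₂ s) h with step⁻ s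
  vertical⇒covers (inj₂ s) h       | (ver , i , t) , c , refl , refl = i , c
  vertical⇒covers (inj₂ s) (h , _) | (hor , i , t) , c , refl , refl = ⊥-elim (1+n≢n h)

corner : LPath → Point
corner P = at (LPath.dir P) (LPath.c P) (LPath.b P)

-- Edges of different directions come from different legs, and the lines of the two legs cross at
-- the corner. The positions `s` and `t` along the lines do not matter, so a bend only has to supply
-- its row and its column.
meet-corner : ∀ {P x y s t} → Covers P (hor , s , y) → Covers P (ver , t , x) →
  (x , y) ≡ corner P
meet-corner {bent hor _ _ _ _ _ _} (leg₁ _ _) (leg₂ _ _) = refl
meet-corner {bent ver _ _ _ _ _ _} (leg₂ _ _) (leg₁ _ _) = refl

realise-atMostOneBend : ∀ P {B} (le : extent P ≤ B) → AtMostOneBend (realise P le)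
realise-atMostOneBend P le β γ = trans (at-corner β) (sym (at-corner γ))
  where
  at-corner : ∀ {p} → IsBend (realise P le) p → p ≡ corner P
  at-corner ((_ , e , h) , (_ , f , v)) =
    meet-corner {P} (proj₂ (horizontal⇒covers P le e h)) (proj₂ (vertical⇒covers P le f v))

ends-injective : ∀ e f → src e ≡ src f → tgt e ≡ tgt f → e ≡ f
ends-injective (hor , _) (hor , _) refl refl = refl
ends-injective (ver , _) (ver , _) refl refl = refl
ends-injective (hor , _) (ver , _) refl ()
ends-injective (ver , _) (hor , _) refl ()

-- `Traverses` ignores orientation. As all unit edges ascend, this excludes a common grid edge
-- traversed in opposite senses.
ends-antisym : ∀ e f → src e ≡ tgt f → tgt e ≡ src f → ⊥
ends-antisym (hor , _) (hor , _) refl ()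
ends-antisym (ver , _) (ver , _) refl ()
ends-antisym (hor , _) (ver , _) refl ()
ends-antisym (ver , _) (hor , _) refl ()

module _ (P Q : LPath) {B : ℕ} (le : extent P ≤ B) (le′ : extent Q ≤ B) where

  share⇒shareEdge : Share P Q → ShareEdge (realise P le) (realise Q le′)
  share⇒shareEdge (e , c , c′) = src e , tgt e , inj₁ (step⁺ P le c) , inj₁ (step⁺ Q le′ c′)

  shareEdge⇒share : ShareEdge (realise P le) (realise Q le′) → Share P Q
  shareEdge⇒share (p , q , inj₁ s , inj₁ s′) with step⁻ P le s | step⁻ Q le′ s′
  ... | e , c , refl , refl | f , c′ , eq₁ , eq₂ = e , c , subst (Covers Q) (sym (ends-injective e f eq₁ eq₂)) c′
  shareEdge⇒share (p , q , inj₂ s , inj₂ s′) with step⁻ P le s | step⁻ Q le′ s′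
  ... | e , c , refl , refl | f , c′ , eq₁ , eq₂ = e , c , subst (Covers Q) (sym (ends-injective e f eq₁ eq₂)) c′
  shareEdge⇒share (p , q , inj₁ s , inj₂ s′) with step⁻ P le s | step⁻ Q le′ s′
  ... | e , c , refl , refl | f , c′ , eq₁ , eq₂ = ⊥-elim (ends-antisym e f eq₂ eq₁)
  shareEdge⇒share (p , q , inj₂ s , inj₁ s′) with step⁻ P le s | step⁻ Q le′ s′
  ... | e , c , refl , refl | f , c′ , eq₁ , eq₂ = ⊥-elim (ends-antisym e f eq₂ eq₁)

-- Drawings of the new vertices around one host edge

-- In a refined grid, moved so that the private edge of the host starts at (2 , 2),
-- the base edges are covered by the host alone, and no old path covers an edge of a free line.
Base Free : ℕ → Edge → Set
Base N (o , s , t) = o ≡ hor × t ≡ 2 × 2 ≤ s × s < 2 + N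
Free N (o , s , t) = 2 < t × t < 2 + N

End : ∀ {k} → Fin k → Set
End {k} i = toℕ i ≡ 0 ⊎ suc (toℕ i) ≡ k

-- Paths for k new vertices in a row, of which the two ends meet the host.
record Gadget (k : ℕ) : Set where
  field
    size    : ℕ
    path    : Fin k → LPath
    zone    : ∀ i {e} → Covers (path i) e → Base (suc size) e ⊎ Free (suc size) e
    touch   : ∀ i → (∃[ e ] Base (suc size) e × Covers (path i) e) ⇔ End i
    link    : ∀ {i j} → i ≢ j → Share (path i) (path j) ⇔ Consecutive (toℕ i) (toℕ j)
    own     : ∀ i → ∃[ e ] Covers (path i) e × Free (suc size) e × (∀ j → j ≢ i → ¬ Covers (path j) e)
    spare   : ∃[ e ] Base (suc size) e × (∀ i → ¬ Covers (path i) e)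

_≟ᵈ_ : DecidableEquality Direction
hor ≟ᵈ hor = yes refl
hor ≟ᵈ ver = no λ ()
ver ≟ᵈ hor = no λ ()
ver ≟ᵈ ver = yes refl

_≟ᵉ_ : DecidableEquality Edge
_≟ᵉ_ = ×-≡-dec _≟ᵈ_ (×-≡-dec _≟ⁿ_ _≟ⁿ_)

_∈ᵉ?_ : (e : Edge) (es : List Edge) → Dec (e ∈ es)
_∈ᵉ?_ = member? _≟ᵉ_

base? : ∀ N e → Dec (Base N e)
base? N (o , s , t) = o ≟ᵈ hor ×-dec t ≟ⁿ 2 ×-dec 2 ≤ⁿ? s ×-dec s <ⁿ? 2 + N

free? : ∀ N e → Dec (Free N e)
free? N (o , s , t) = 2 <ⁿ? t ×-dec t <ⁿ? 2 + N

module _ {k : ℕ} (N : ℕ) (path : Fin k → LPath) (f : Edge) where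

  -- The clauses of `Gadget` over finite lists of edges, with `f` as the spare edge. In this form
  -- they are decidable, and the drawings of fixed size are checked by evaluation.
  Verified : Set
  Verified =
    (∀ i → All (λ e → Base N e ⊎ Free N e) (edges (path i))) ×
    (∀ i → (Any (Base N) (edges (path i)) → End i) × (End i → Any (Base N) (edges (path i)))) ×
    (∀ i j → i ≢ j →
      (Any (_∈ edges (path j)) (edges (path i)) → Consecutive (toℕ i) (toℕ j)) ×
      (Consecutive (toℕ i) (toℕ j) → Any (_∈ edges (path j)) (edges (path i)))) ×
    (∀ i → Any (λ e → Free N e × (∀ j → j ≢ i → e ∉ edges (path j))) (edges (path i))) ×
    Base N f × (∀ i → f ∉ edges (path i))

  end? : (i : Fin k) → Dec (End i)
  end? i = toℕ i ≟ⁿ 0 ⊎-dec suc (toℕ i) ≟ⁿ k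

  consecutive? : ∀ i j → Dec (Consecutive i j)
  consecutive? i j = j ≟ⁿ suc i ⊎-dec i ≟ⁿ suc j

  verified? : Dec Verified
  verified? =
    allᶠ? (λ i → All.all? (λ e → base? N e ⊎-dec free? N e) (edges (path i))) ×-dec
    allᶠ? (λ i → (any? (base? N) (edges (path i)) →-dec end? i) ×-dec (end? i →-dec any? (base? N) (edges (path i)))) ×-dec
    allᶠ? (λ i → allᶠ? λ j → ¬? (i ≟ᶠ j) →-dec
      ((any? (_∈ᵉ? edges (path j)) (edges (path i)) →-dec consecutive? (toℕ i) (toℕ j)) ×-dec
       (consecutive? (toℕ i) (toℕ j) →-dec any? (_∈ᵉ? edges (path j)) (edges (path i))))) ×-dec
    allᶠ? (λ i → any? (λ e → free? N e ×-dec allᶠ? λ j → ¬? (j ≟ᶠ i) →-dec ¬? (e ∈ᵉ? edges (path j))) (edges (path i))) ×-dec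
    base? N f ×-dec allᶠ? (λ i → ¬? (f ∈ᵉ? edges (path i)))

verified⇒gadget : ∀ {k} N (path : Fin k → LPath) f → Verified (suc N) path f → Gadget k
verified⇒gadget N path f (zone , touch , link , own , base , spare) = record
  { size  = N
  ; path  = path
  ; zone  = λ i c → All.lookup (zone i) (covers⇒∈edges c)
  ; touch = λ i → mk⇔
      (λ { (e , b , c) → proj₁ (touch i) (lose (covers⇒∈edges c) b) })
      (λ end → let e , e∈ , b = find (proj₂ (touch i) end) in e , b , ∈edges⇒covers e∈)
  ; link  = λ {i} {j} i≢j → mk⇔
      (λ { (e , c , c′) → proj₁ (link i j i≢j) (lose (covers⇒∈edges c) (covers⇒∈edges c′)) })
      (λ adj → let e , e∈ , e∈′ = find (proj₂ (link i j i≢j) adj) in e , ∈edges⇒covers e∈ , ∈edges⇒covers e∈′)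
  ; own   = λ i → let e , e∈ , free , e∉ = find (own i) in
      e , ∈edges⇒covers e∈ , free , λ j j≢i c → e∉ j j≢i (covers⇒∈edges c)
  ; spare = f , base , λ i c → spare i (covers⇒∈edges c)
  }

≤! : ∀ {a b} {_ : True (a ≤ⁿ? b)} → a ≤ b
≤! {_} {_} {t} = toWitness t

pendant : Gadget 1
-- The refinement factor 10 is not tight; it only has to make room for the columns in use and the
-- spare edge.
pendant = verified⇒gadget 9 path (hor , 3 , 2) (toWitness {a? = verified? 10 path (hor , 3 , 2)} _)
  where
  path : Fin 1 → LPath
  path _ = bent hor 2 2 3 3 ≤! ≤!

-- The first base edge lies on both paths and on the host, which gives all three adjacencies; the
-- paths then turn up in different columns to obtain private edges.
triangle : Gadget 2
triangle = verified⇒gadget 9 path (hor , 4 , 2) (toWitness {a? = verified? 10 path (hor , 4 , 2)} _)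
  where
  path : Fin 2 → LPath
  path zero    = bent hor 2 2 3 3 ≤! ≤!
  path (suc _) = bent hor 2 2 4 3 ≤! ≤!

-- The first and third path bend at the same point of the host, into opposite
-- quadrants, and the second one passes vertically through that point.
quadrilateral : Gadget 3
quadrilateral = verified⇒gadget 9 path (hor , 4 , 2) (toWitness {a? = verified? 10 path (hor , 4 , 2)} _)
  where
  path : Fin 3 → LPath
  path zero          = bent hor 2 2 3 4 ≤! ≤!
  path (suc zero)    = bent ver 1 3 3 4 ≤! ≤!
  path (suc (suc _)) = bent ver 0 3 2 4 ≤! ≤!

double : ℕ → ℕ
double zero    = zero
double (suc n) = suc (suc (double n))

double-cancel-≤ : ∀ {i j} → double i ≤ suc (double j) → i ≤ j
double-cancel-≤ {zero}  {j}     _             = z≤n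
double-cancel-≤ {suc i} {zero}  (s≤s ())
double-cancel-≤ {suc i} {suc j} (s≤s (s≤s p)) = s≤s (double-cancel-≤ p)

-- The two end paths turn up from the host; the others overlap successively on row 4,
-- the i-th (counted from 0) occupying columns 2i + 1 to 2i + 4.
data Position (m : ℕ) : ℕ → Set where
  isFirst  : Position m 0
  isSecond : Position m 1
  isMiddle : ∀ {j} → j < m → Position m (2 + j)
  isPenult : Position m (2 + m)
  isLast   : Position m (3 + m)

position : ∀ m i → i < 4 + m → Position m i
position m 0 _ = isFirst
position m 1 _ = isSecond
position m (suc (suc j)) (s≤s (s≤s (s≤s j≤))) with m≤n⇒m<n∨m≡n j≤
... | inj₂ refl = isLast
... | inj₁ (s≤s j≤m) with m≤n⇒m<n∨m≡n j≤m
...   | inj₁ j<m  = isMiddle j<m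
...   | inj₂ refl = isPenult

pathAt : ∀ {m i} → Position m i → LPath
pathAt isFirst              = bent hor 2 2 3 4 ≤! ≤!
pathAt isSecond             = bent ver 3 3 4 6 ≤! ≤!
pathAt (isMiddle {j} _)     = bent hor (5 + double j) 4 (8 + double j) 4 (m≤n+m _ 3) ≤!
pathAt {m} isPenult         = bent hor (5 + double m) 4 (8 + double m) 5 (m≤n+m _ 3) ≤!
pathAt {m} isLast           = bent hor (7 + double m) 2 (8 + double m) 5 (n≤1+n _) ≤!

-- An outer bound for the edges of the i-th path, uniform in i, so that two paths are compared by
-- matching on the edge instead of on pairs of positions. The row conditions in `onLeft` and
-- `onRight` leave the lower part of each column to the end path alone.
data Strip (m : ℕ) : ℕ → Edge → Set where
  onRow      : ∀ {i s} → suc (double i) ≤ s → s < 4 + double i → Strip m i (hor , s , 4)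
  onLeft     : ∀ {i s} → i ≤ 1 → (3 ≤ s ⊎ i ≡ 0) → Strip m i (ver , s , 3)
  onRight    : ∀ {i s} → 2 + m ≤ i → i ≤ 3 + m → (4 ≤ s ⊎ i ≡ 3 + m) → Strip m i (ver , s , 8 + double m)
  atStart    : Strip m 0 (hor , 2 , 2)
  atEnd      : Strip m (3 + m) (hor , 7 + double m , 2)

strip : ∀ {m i e} (p : Position m i) → Covers (pathAt p) e → Strip m i e
strip isFirst      (leg₁ p q) with refl ← ≤-antisym p (s≤s⁻¹ q) = atStart
strip isFirst      (leg₂ p q) = onLeft z≤n (inj₂ refl)
strip isSecond     (leg₁ p q) = onLeft ≤-refl (inj₁ p)
strip isSecond     (leg₂ p q) = onRow p q
strip (isMiddle _) (leg₁ p q) = onRow p q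
strip (isMiddle _) (leg₂ p q) = ⊥-elim (1+n≰n (≤-trans q p))
strip isPenult     (leg₁ p q) = onRow p q
strip isPenult     (leg₂ p q) = onRight ≤-refl (n≤1+n _) (inj₁ p)
strip isLast       (leg₁ p q) with refl ← ≤-antisym p (s≤s⁻¹ q) = atEnd
strip isLast       (leg₂ p q) = onRight (n≤1+n _) ≤-refl (inj₂ refl)

strip-zone : ∀ {m i e} → Strip m i e → Base (8 + double m) e ⊎ Free (8 + double m) e
strip-zone (onRow _ _)     = inj₂ (≤! , s≤s (s≤s (s≤s (s≤s (s≤s z≤n)))))
strip-zone (onLeft _ _)    = inj₂ (≤! , s≤s (s≤s (s≤s (s≤s z≤n))))
strip-zone (onRight _ _ _) = inj₂ (s≤s (s≤s (s≤s z≤n)) , n≤1+n _)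
strip-zone atStart         = inj₁ (refl , refl , ≤! , s≤s (s≤s (s≤s z≤n)))
strip-zone atEnd           = inj₁ (refl , refl , s≤s (s≤s z≤n) , m≤n+m _ 2)

strip-base : ∀ {m i e} → Base (8 + double m) e → Strip m i e → i ≡ 0 ⊎ suc i ≡ 4 + m
strip-base _ atStart = inj₁ refl
strip-base _ atEnd   = inj₂ refl
strip-base (_ , () , _) (onRow _ _)

-- On row 4, 2i + 1 ≤ s < 2j + 4 forces i ≤ j + 1, and each outer column serves only two successive
-- paths. Applied in both orders, this leaves only neighbours.
strip-near : ∀ {m i j e} → Strip m i e → Strip m j e → i ≤ suc j
strip-near (onRow p _) (onRow _ q) = double-cancel-≤ (≤-trans (n≤1+n _) (s≤s⁻¹ (≤-trans (s≤s p) q)))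
strip-near (onLeft p _)    (onLeft _ _)    = ≤-trans p (s≤s z≤n)
strip-near (onRight _ p _) (onRight q _ _) = ≤-trans p (s≤s q)
strip-near atStart         atStart         = z≤n
strip-near atEnd           atEnd           = n≤1+n _

near⇒consecutive : ∀ {i j} → i ≢ j → i ≤ suc j → j ≤ suc i → Consecutive i j
near⇒consecutive i≢j p q with m≤n⇒m<n∨m≡n p | m≤n⇒m<n∨m≡n q
... | inj₂ refl | _         = inj₂ refl
... | _         | inj₂ refl = inj₁ refl
... | inj₁ (s≤s p′) | inj₁ (s≤s q′) = ⊥-elim (i≢j (≤-antisym p′ q′))

-- On row 4 the last edge of the i-th path, in column 2i + 3, is the first edge of the next one. The
-- end paths meet their neighbours in the outer columns.
share-next : ∀ {m i} → suc i < 4 + m → (p : Position m i) (q : Position m (suc i)) → Share (pathAt p) (pathAt q)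
share-next _ isFirst      isSecond          = (ver , 3 , 3) , leg₂ ≤! ≤! , leg₁ ≤! ≤!
share-next _ isSecond     (isMiddle _)      = (hor , 5 , 4) , leg₂ ≤! ≤! , leg₁ ≤! ≤!
share-next _ isSecond     isPenult          = (hor , 5 , 4) , leg₂ ≤! ≤! , leg₁ ≤! ≤!
share-next _ (isMiddle {j} _) (isMiddle _)  = (hor , 7 + double j , 4) , leg₁ (m≤n+m _ 2) ≤-refl , leg₁ ≤-refl (m≤n+m _ 2)
share-next _ (isMiddle {j} _) isPenult      = (hor , 7 + double j , 4) , leg₁ (m≤n+m _ 2) ≤-refl , leg₁ ≤-refl (m≤n+m _ 2)
share-next _ (isMiddle p) isLast            = ⊥-elim (1+n≰n p)
share-next _ isPenult     (isMiddle p)      = ⊥-elim (1+n≰n (≤-trans (n≤1+n _) p))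
share-next {m} _ isPenult isLast            = (ver , 4 , 8 + double m) , leg₂ ≤! ≤! , leg₂ ≤! ≤!
share-next p isLast       _               = ⊥-elim (1+n≰n p)

share-sym : ∀ {P Q} → Share P Q → Share Q P
share-sym (e , c , c′) = e , c′ , c

-- The middle one of the three row edges: the outer two are those reserved for the predecessor and
-- the successor.
own-row : ∀ {m i P} → Covers P (hor , 2 + double i , 4) →
  ∃[ e ] Covers P e × Free (8 + double m) e × (∀ {j} → Strip m j e → j ≡ i)
own-row {m} {i} c = (hor , 2 + double i , 4) , c , (≤! , s≤s (s≤s (s≤s (s≤s (s≤s z≤n))))) , only
  where
  only : ∀ {j} → Strip m j (hor , 2 + double i , 4) → j ≡ i
  only (onRow (s≤s p) (s≤s (s≤s q))) = ≤-antisym (double-cancel-≤ p) (double-cancel-≤ (s≤s⁻¹ q))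

own-strip : ∀ {m i} (p : Position m i) →
  ∃[ e ] Covers (pathAt p) e × Free (8 + double m) e × (∀ {j} → Strip m j e → j ≡ i)
own-strip {m} isFirst = (ver , 2 , 3) , leg₂ ≤! ≤! , strip-free , only
  where
  strip-free = ≤! , s≤s (s≤s (s≤s (s≤s z≤n)))
  only : ∀ {j} → Strip m j (ver , 2 , 3) → j ≡ 0
  only (onLeft _ (inj₁ (s≤s (s≤s ()))))
  only (onLeft _ (inj₂ eq)) = eq
own-strip {m} isLast = (ver , 2 , 8 + double m) , leg₂ ≤! ≤! , (s≤s (s≤s (s≤s z≤n)) , n≤1+n _) , only
  where
  only : ∀ {j} → Strip m j (ver , 2 , 8 + double m) → j ≡ 3 + m
  only (onRight _ _ (inj₁ (s≤s (s≤s ()))))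
  only (onRight _ _ (inj₂ eq)) = eq
own-strip isSecond         = own-row {i = 1} (leg₂ ≤! ≤!)
own-strip (isMiddle {j} _) = own-row {i = 2 + j} (leg₁ (n≤1+n _) (n≤1+n _))
own-strip {m} isPenult     = own-row {i = 2 + m} (leg₁ (n≤1+n _) (n≤1+n _))

cycle : ∀ m → Gadget (4 + m)
cycle m = record
  { size  = 7 + double m
  ; path  = path
  ; zone  = λ i c → strip-zone (strip (pos i) c)
  ; touch = λ i → mk⇔ (λ { (e , b , c) → strip-base b (strip (pos i) c) }) (touching (pos i))
  ; link  = λ {i} {j} i≢j → mk⇔
      (λ { (e , c , c′) → near⇒consecutive (λ eq → i≢j (toℕ-injective eq))
             (strip-near (strip (pos i) c) (strip (pos j) c′))
             (strip-near (strip (pos j) c′) (strip (pos i) c)) })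
      (linking i j (pos i) (pos j))
  ; own   = λ i → let e , c , free , only = own-strip (pos i) in
      e , c , free , λ j j≢i c′ → j≢i (toℕ-injective (only (strip (pos j) c′)))
  ; spare = (hor , 3 , 2) , (refl , refl , ≤! , s≤s (s≤s (s≤s (s≤s z≤n)))) , λ i c → unused (strip (pos i) c)
  }
  where
  pos : (i : Fin (4 + m)) → Position m (toℕ i)
  pos i = position m (toℕ i) (toℕ<n i)

  path : Fin (4 + m) → LPath
  path i = pathAt (pos i)

  touching : ∀ {i} (p : Position m i) → i ≡ 0 ⊎ suc i ≡ 4 + m → ∃[ e ] Base (8 + double m) e × Covers (pathAt p) e
  touching isFirst _ = (hor , 2 , 2) , (refl , refl , ≤! , s≤s (s≤s (s≤s z≤n))) , leg₁ ≤! ≤!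
  touching isLast  _ = (hor , 7 + double m , 2) , (refl , refl , s≤s (s≤s z≤n) , m≤n+m _ 2) , leg₁ ≤-refl ≤-refl
  touching isSecond     (inj₂ ())
  touching isPenult     (inj₂ eq) = ⊥-elim (1+n≢n (sym (suc-injective (suc-injective (suc-injective eq)))))
  touching (isMiddle p) (inj₂ refl) = ⊥-elim (1+n≰n (≤-trans (n≤1+n _) p))

  linking : ∀ i j (p : Position m (toℕ i)) (q : Position m (toℕ j)) →
    Consecutive (toℕ i) (toℕ j) → Share (pathAt p) (pathAt q)
  linking i j p q (inj₁ eq) with toℕ j | toℕ<n j
  linking i j p q (inj₁ refl) | _ | lt = share-next lt p q
  linking i j p q (inj₂ eq) with toℕ i | toℕ<n i
  linking i j p q (inj₂ refl) | _ | lt = share-sym (share-next lt q p)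

  unused : ∀ {i} → ¬ Strip m i (hor , 3 , 2)
  unused ()

gadget : ∀ k → Gadget (suc k)
gadget 0                   = pendant
gadget 1                   = triangle
gadget 2                   = quadrilateral
gadget (suc (suc (suc m))) = cycle m

-- Reflection, refinement and translation

flip : LPath → LPath
flip (bent o a b c d p q) = bent (opposite o) a b c d p q

flip⁺ : ∀ {P o s t} → Covers P (o , s , t) → Covers (flip P) (opposite o , s , t)
flip⁺ (leg₁ p q) = leg₁ p q
flip⁺ (leg₂ p q) = leg₂ p q

flip⁻ : ∀ {P o s t} → Covers (flip P) (o , s , t) → Covers P (opposite o , s , t)
flip⁻ {bent hor _ _ _ _ _ _} (leg₁ p q) = leg₁ p q
flip⁻ {bent hor _ _ _ _ _ _} (leg₂ p q) = leg₂ p q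
flip⁻ {bent ver _ _ _ _ _ _} (leg₁ p q) = leg₁ p q
flip⁻ {bent ver _ _ _ _ _ _} (leg₂ p q) = leg₂ p q

-- The margin 2 leaves room for the quadrilateral below the host.
grow : ℕ → ℕ → ℕ
grow N x = 2 + x * N

grow-mono : ∀ N {x y} → x ≤ y → grow N x ≤ grow N y
grow-mono N p = s≤s (s≤s (*-monoˡ-≤ N p))

scale : ℕ → LPath → LPath
scale N (bent o a b c d p q) = bent o (grow N a) (grow N b) (grow N c) (grow N d) (grow-mono N p) (grow-mono N q)

interval⁺ : ∀ N {r a s c} → r < N → a ≤ s → s < c → grow N a ≤ 2 + (r + s * N) × 2 + (r + s * N) < grow N c
interval⁺ N {r} {a} {s} {c} r<N a≤s s<c =
  s≤s (s≤s (≤-trans (*-monoˡ-≤ N a≤s) (m≤n+m _ r))) ,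
  s≤s (s≤s (≤-trans (+-monoˡ-< (s * N) r<N) (*-monoˡ-≤ N s<c)))

interval⁻ : ∀ M {a c x} → let N = suc M in grow N a ≤ x → x < grow N c →
  ∃[ r ] ∃[ s ] r < N × x ≡ 2 + (r + s * N) × a ≤ s × s < c
interval⁻ M {a} {c} {suc (suc x)} (s≤s (s≤s p)) (s≤s (s≤s q)) =
  x % suc M , x / suc M , m%n<n x (suc M) , cong (2 +_) (m≡m%n+[m/n]*n x (suc M)) ,
  subst (_≤ x / suc M) (m*n/n≡m a (suc M)) (/-monoˡ-≤ (suc M) p) , m<n*o⇒m/o<n q

scale⁺ : ∀ {N P o s t r} → r < N → Covers P (o , s , t) → Covers (scale N P) (o , 2 + (r + s * N) , grow N t)
scale⁺ {N} r<N (leg₁ p q) = let p′ , q′ = interval⁺ N r<N p q in leg₁ p′ q′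
scale⁺ {N} r<N (leg₂ p q) = let p′ , q′ = interval⁺ N r<N p q in leg₂ p′ q′

scale⁻ : ∀ {M P o x y} → let N = suc M in Covers (scale N P) (o , x , y) →
  ∃[ r ] ∃[ s ] ∃[ t ] r < N × x ≡ 2 + (r + s * N) × y ≡ grow N t × Covers P (o , s , t)
scale⁻ {M} {bent o a b c d _ _} (leg₁ p q) =
  let r , s , r<N , eq , p′ , q′ = interval⁻ M p q in r , s , b , r<N , eq , refl , leg₁ p′ q′
scale⁻ {M} {bent o a b c d _ _} (leg₂ p q) =
  let r , s , r<N , eq , p′ , q′ = interval⁻ M p q in r , s , c , r<N , eq , refl , leg₂ p′ q′

divMod-unique : ∀ M {r r′ q q′} → let N = suc M in r < N → r′ < N → r + q * N ≡ r′ + q′ * N → r ≡ r′ × q ≡ q′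
divMod-unique M {r} {r′} {q} {q′} r<N r′<N eq =
  r≡r′ , *-cancelʳ-≡ q q′ (suc M) (+-cancelˡ-≡ r _ _ (trans eq (cong (_+ q′ * suc M) (sym r≡r′))))
  where
  rem : ∀ {r} q → r < suc M → (r + q * suc M) % suc M ≡ r
  rem {r} q r<N = trans ([m+kn]%n≡m%n r q (suc M)) (m<n⇒m%n≡m r<N)
  r≡r′ : r ≡ r′
  r≡r′ = trans (sym (rem q r<N)) (trans (cong (_% suc M) eq) (rem q′ r′<N))

share-scale : ∀ M {P Q} → Share P Q ⇔ Share (scale (suc M) P) (scale (suc M) Q)
share-scale M {P} {Q} = mk⇔ (λ { (_ , c , c′) → _ , scale⁺ z<s c , scale⁺ z<s c′ }) back
  where
  back : Share (scale (suc M) P) (scale (suc M) Q) → Share P Q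
  back (_ , c , c′) with scale⁻ {P = P} c | scale⁻ {P = Q} c′
  ... | r , s , t , r< , refl , refl , d | r′ , s′ , t′ , r′< , eq , eq′ , d′
    with divMod-unique M {q = s} {q′ = s′} r< r′< (+-cancelˡ-≡ 2 _ _ eq) | *-cancelʳ-≡ t t′ (suc M) (+-cancelˡ-≡ 2 _ _ eq′)
  ... | refl , refl | refl = _ , d , d′

module _ (off : Direction → ℕ) where

  translateᵉ : Edge → Edge
  translateᵉ (o , s , t) = o , s + off o , t + off (opposite o)

  translate : LPath → LPath
  translate (bent o a b c d p q) =
    bent o (a + off o) (b + off (opposite o)) (c + off o) (d + off (opposite o))
      (+-monoˡ-≤ (off o) p) (+-monoˡ-≤ (off (opposite o)) q)

  translate⁺ : ∀ {P e} → Covers P e → Covers (translate P) (translateᵉ e)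
  translate⁺ {bent hor _ _ _ _ _ _} (leg₁ p q) = leg₁ (+-monoˡ-≤ _ p) (+-monoˡ-< _ q)
  translate⁺ {bent ver _ _ _ _ _ _} (leg₁ p q) = leg₁ (+-monoˡ-≤ _ p) (+-monoˡ-< _ q)
  translate⁺ {bent hor _ _ _ _ _ _} (leg₂ p q) = leg₂ (+-monoˡ-≤ _ p) (+-monoˡ-< _ q)
  translate⁺ {bent ver _ _ _ _ _ _} (leg₂ p q) = leg₂ (+-monoˡ-≤ _ p) (+-monoˡ-< _ q)

  interval-translate⁻ : ∀ k {a c x} → a + k ≤ x → x < c + k → ∃[ s ] x ≡ s + k × a ≤ s × s < c
  interval-translate⁻ k {a} {c} {x} p q = x ∸ k , sym eq ,
    +-cancelʳ-≤ k a (x ∸ k) (subst (a + k ≤_) (sym eq) p) , +-cancelʳ-< k (x ∸ k) c (subst (_< c + k) (sym eq) q)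
    where
    eq : x ∸ k + k ≡ x
    eq = m∸n+n≡m (≤-trans (m≤n+m k a) p)

  translate⁻ : ∀ {P e} → Covers (translate P) e → ∃[ f ] e ≡ translateᵉ f × Covers P f
  translate⁻ {bent hor _ _ _ _ _ _} (leg₁ p q) with _ , refl , p′ , q′ ← interval-translate⁻ (off hor) p q = _ , refl , leg₁ p′ q′
  translate⁻ {bent ver _ _ _ _ _ _} (leg₁ p q) with _ , refl , p′ , q′ ← interval-translate⁻ (off ver) p q = _ , refl , leg₁ p′ q′
  translate⁻ {bent hor _ _ _ _ _ _} (leg₂ p q) with _ , refl , p′ , q′ ← interval-translate⁻ (off ver) p q = _ , refl , leg₂ p′ q′
  translate⁻ {bent ver _ _ _ _ _ _} (leg₂ p q) with _ , refl , p′ , q′ ← interval-translate⁻ (off hor) p q = _ , refl , leg₂ p′ q′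

  translateᵉ-injective : ∀ {e f} → translateᵉ e ≡ translateᵉ f → e ≡ f
  translateᵉ-injective {o , s , t} {o′ , s′ , t′} eq with refl ← ,-injectiveˡ eq =
    cong (o ,_) (cong₂ _,_ (+-cancelʳ-≡ (off o) s s′ (cong (proj₁ ∘ proj₂) eq))
                           (+-cancelʳ-≡ (off (opposite o)) t t′ (cong (proj₂ ∘ proj₂) eq)))

  covers-translate : ∀ {P e} → Covers (translate P) (translateᵉ e) → Covers P e
  covers-translate {P} c with f , eq , d ← translate⁻ {P} c = subst (Covers P) (sym (translateᵉ-injective eq)) d

  share-translate : ∀ {P Q} → Share P Q ⇔ Share (translate P) (translate Q)
  share-translate {P} {Q} = mk⇔ (λ { (_ , c , c′) → _ , translate⁺ c , translate⁺ c′ }) back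
    where
    back : Share (translate P) (translate Q) → Share P Q
    back (_ , c , c′) with f , refl , d ← translate⁻ {P} c = f , d , covers-translate c′

-- Takes (2 , 2) to (`grow N s` , `grow N t`), the beginning of the scaled host edge. The margin of
-- `grow` is already part of the gadget coordinates, so both offsets are multiples of N.
offset : ℕ → ℕ → ℕ → Direction → ℕ
offset N s t hor = s * N
offset N s t ver = t * N

-- After subtraction of 2, old lines have residue 0 modulo N, whereas a free line keeps its nonzero
-- residue under the offset.
offset-line : ∀ {M s t o x} → let N = suc M in 2 < x → x < 2 + N → ∀ {y} → x + offset N s t o ≢ grow N y
offset-line {M} {s} {t} {o} {suc (suc (suc x))} (s≤s (s≤s (s≤s _))) (s≤s (s≤s q)) {y} eq = clash o eq
  where
  clash : ∀ o → 3 + x + offset (suc M) s t o ≢ grow (suc M) y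
  clash hor eq with () ← proj₁ (divMod-unique M {r′ = 0} {q = s} {q′ = y} q z<s (+-cancelˡ-≡ 2 _ _ eq))
  clash ver eq with () ← proj₁ (divMod-unique M {r′ = 0} {q = t} {q′ = y} q z<s (+-cancelˡ-≡ 2 _ _ eq))

module _ {M s t : ℕ} where

  private
    N = suc M

  -- Residues keep old paths off the free lines; on a base edge, quotients modulo N recover the
  -- original edge. Hence old and new paths can only meet along the private edge of the host.
  scaled-in-zone : ∀ {P e} → Covers (scale N P) (translateᵉ (offset N s t) e) →
    Base N e ⊎ Free N e → Base N e × Covers P (hor , s , t)
  scaled-in-zone {P} {o , x , y} c (inj₂ (p , q)) with scale⁻ {P = P} c
  ... | _ , _ , t′ , _ , _ , eq , _ = ⊥-elim (offset-line {M} {s} {t} {opposite o} {y} p q {t′} eq)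
  scaled-in-zone {P} {_ , suc (suc x) , _} c (inj₁ base@(refl , refl , s≤s (s≤s _) , s≤s (s≤s x<N))) with scale⁻ {P = P} c
  ... | r , s′ , t′ , r<N , eq , eq′ , d
    with divMod-unique M {q = s} {q′ = s′} x<N r<N (+-cancelˡ-≡ 2 _ _ eq) | *-cancelʳ-≡ t t′ (suc M) (+-cancelˡ-≡ 2 _ _ eq′)
  ... | refl , refl | refl = base , d

  covers-base : ∀ {P e} → Base N e → Covers P (hor , s , t) → Covers (scale N P) (translateᵉ (offset N s t) e)
  covers-base {P} {_ , suc (suc x) , _} (refl , refl , s≤s (s≤s _) , s≤s (s≤s x<N)) c = scale⁺ x<N c

-- Attachment of new vertices to a host

module _ {n : ℕ} (G : Graph n) where
  open Graph G using (Adj) renaming (sym to adj-sym)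

  record Representation (S : List (Fin n)) : Set where
    field
      path  : Fin n → LPath
      share : ∀ {u v} → u ∈ S → v ∈ S → u ≢ v → Adj u v ⇔ Share (path u) (path v)
      own   : ∀ {v} → v ∈ S → ∃[ e ] Covers (path v) e × (∀ {u} → u ∈ S → u ≢ v → ¬ Covers (path u) e)

  -- Gadgets expect a horizontal host edge. Reflection in the diagonal makes a vertical one
  -- horizontal and preserves monotonicity and the number of bends.
  flipped : ∀ {S} → Representation S → Representation S
  flipped R = record
    { path  = flip ∘ path
    ; share = λ u∈ v∈ u≢v → mk⇔
        (λ adj → let e , c , c′ = to (share u∈ v∈ u≢v) adj in _ , flip⁺ c , flip⁺ c′)
        (λ { (e , c , c′) → from (share u∈ v∈ u≢v) (_ , flip⁻ c , flip⁻ c′) })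
    ; own   = λ v∈ → let (o , s , t) , c , only = own v∈ in
        (opposite o , s , t) , flip⁺ c , λ u∈ u≢v c′ → only u∈ u≢v (opp-opp o (flip⁻ c′))
    }
    where
    open Representation R
    opp-opp : ∀ o {P s t} → Covers P (opposite (opposite o) , s , t) → Covers P (o , s , t)
    opp-opp hor c = c
    opp-opp ver c = c

  module _ {S L : List (Fin n)} {v : Fin n} (v∈S : v ∈ S)
    (lookup-inj : Injective _≡_ _≡_ (lookup L)) (fresh : ∀ i → lookup L i ∉ S)
    (inner : ∀ {i j} → i ≢ j → Adj (lookup L i) (lookup L j) ⇔ Consecutive (toℕ i) (toℕ j))
    (outer : ∀ i {u} → u ∈ S → Adj (lookup L i) u ⇔ (u ≡ v × End i))
    (gadget : Gadget (length L))
    where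

    private
      module D = Gadget gadget

      N : ℕ
      N = suc D.size

    attachAt : (R : Representation S) (let open Representation R) → ∀ {s t} → Covers (path v) (hor , s , t) →
      (∀ {u} → u ∈ S → u ≢ v → ¬ Covers (path u) (hor , s , t)) → Representation (L ++ S)
    attachAt R {s} {t} host only = record
      { path  = path′
      ; share = λ u∈ w∈ → sharing (placed u∈) (placed w∈)
      ; own   = λ u∈ → owning (placed u∈)
      }
      where
      open Representation R

      off = offset N s t
      old = λ u → scale N (path u)
      new = λ i → translate off (D.path i)

      -- Separate from `path′`, so that an equation for the decision becomes an equation for
      -- `path′ u` by congruence.
      choose : ∀ u → Dec (∃[ i ] lookup L i ≡ u) → LPath
      choose u (yes (i , _)) = new i
      choose u (no _)        = old u

      path′ : Fin n → LPath
      path′ u = choose u (anyᶠ? (λ i → lookup L i ≟ᶠ u))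

      data Placed (u : Fin n) : Set where
        isNew : ∀ i → lookup L i ≡ u → path′ u ≡ new i → Placed u
        isOld : u ∈ S → path′ u ≡ old u → Placed u

      placed : ∀ {u} → u ∈ L ++ S → Placed u
      placed {u} u∈ with anyᶠ? (λ i → lookup L i ≟ᶠ u) in eq
      ... | yes (i , l) = isNew i l (cong (choose u) eq)
      ... | no ∄i with ∈-++⁻ L u∈
      ...   | inj₁ u∈L = ⊥-elim (∄i (index u∈L , sym (lookup-index u∈L)))
      ...   | inj₂ u∈S = isOld u∈S (cong (choose u) eq)

      covered-by-host : ∀ {u i e} → u ∈ S → Covers (new i) e → Covers (old u) e →
        u ≡ v × (∃[ f ] e ≡ translateᵉ off f × Base N f × Covers (D.path i) f)
      covered-by-host {u} {i} u∈ c c′ with translate⁻ off {D.path i} c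
      ... | f , refl , d with scaled-in-zone {P = path u} {f} c′ (D.zone i d) | u ≟ᶠ v
      ...   | base , _  | yes u≡v = u≡v , f , refl , base , d
      ...   | base , c″ | no u≢v  = ⊥-elim (only u∈ u≢v c″)

      mixed : ∀ i {u} → u ∈ S → Adj (lookup L i) u ⇔ Share (new i) (old u)
      mixed i {u} u∈ = mk⇔ there′ back
        where
        there′ : Adj (lookup L i) u → Share (new i) (old u)
        there′ adj with to (outer i u∈) adj
        ... | refl , end with from (D.touch i) end
        ...   | e , base , c = _ , translate⁺ off c , covers-base {P = path u} base host
        back : Share (new i) (old u) → Adj (lookup L i) u
        back (e , c , c′) with covered-by-host u∈ c c′
        ... | u≡v , f , _ , base , d = from (outer i u∈) (u≡v , to (D.touch i) (f , base , d))

      sharing : ∀ {u w} → Placed u → Placed w → u ≢ w → Adj u w ⇔ Share (path′ u) (path′ w)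
      sharing (isNew i refl eq) (isNew j refl eq′) u≢w rewrite eq | eq′ = mk⇔
        (λ adj → to (share-translate off) (from (D.link i≢j) (to (inner i≢j) adj)))
        (λ sh → from (inner i≢j) (to (D.link i≢j) (from (share-translate off) sh)))
        where i≢j = λ i≡j → u≢w (cong (lookup L) i≡j)
      sharing (isNew i refl eq) (isOld w∈ eq′) u≢w rewrite eq | eq′ = mixed i w∈
      sharing (isOld u∈ eq) (isNew i refl eq′) u≢w rewrite eq | eq′ = mk⇔
        (λ adj → share-sym (to (mixed i u∈) (adj-sym adj)))
        (λ sh → adj-sym (from (mixed i u∈) (share-sym sh)))
      sharing {u} {w} (isOld u∈ eq) (isOld w∈ eq′) u≢w rewrite eq | eq′ = mk⇔
        (λ adj → to (share-scale D.size) (to (share u∈ w∈ u≢w) adj))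
        (λ sh → from (share u∈ w∈ u≢w) (from (share-scale D.size) sh))

      owning : ∀ {u} → Placed u →
        ∃[ e ] Covers (path′ u) e × (∀ {w} → w ∈ L ++ S → w ≢ u → ¬ Covers (path′ w) e)
      -- This edge lies on a free line, so old paths miss it as well.
      owning (isNew i refl eq) rewrite eq with D.own i
      ... | e , c , free , others = _ , translate⁺ off c , λ w∈ w≢u c′ → avoid (placed w∈) w≢u c′
        where
        avoid : ∀ {w} → Placed w → w ≢ lookup L i → ¬ Covers (path′ w) (translateᵉ off e)
        avoid (isNew j refl eq) w≢u c′ rewrite eq = others j (λ { refl → w≢u refl }) (covers-translate off c′)
        avoid {w} (isOld w∈ eq) w≢u c′ rewrite eq with scaled-in-zone {P = path w} {e} c′ (inj₂ free)
        ... | (_ , refl , _) , _ = <-irrefl refl (proj₁ free)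
      owning {u} (isOld u∈ eq) rewrite eq with u ≟ᶠ v
      ... | yes refl = _ , covers-base {P = path v} (proj₁ (proj₂ D.spare)) host , λ w∈ w≢u c′ → avoid (placed w∈) w≢u c′
        where
        e = proj₁ D.spare
        avoid : ∀ {w} → Placed w → w ≢ v → ¬ Covers (path′ w) (translateᵉ off e)
        avoid (isNew j refl eq) w≢u c′ rewrite eq = proj₂ (proj₂ D.spare) j (covers-translate off c′)
        avoid {w} (isOld w∈ eq) w≢u c′ rewrite eq =
          only w∈ w≢u (proj₂ (scaled-in-zone {P = path w} {e} c′ (inj₁ (proj₁ (proj₂ D.spare)))))
      ... | no u≢v with own u∈
      -- The witness is the first of the N parts of the old private edge, with remainder 0. A new
      -- path could only cover it if `u` were the host.
      ...   | (o , x , y) , c , others = _ , scale⁺ z<s c , λ w∈ w≢u c′ → avoid (placed w∈) w≢u c′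
        where
        avoid : ∀ {w} → Placed w → w ≢ u → ¬ Covers (path′ w) (o , 2 + (0 + x * N) , grow N y)
        avoid (isNew j refl eq) w≢u c′ rewrite eq = u≢v (proj₁ (covered-by-host {i = j} u∈ c′ (scale⁺ z<s c)))
        avoid {w} (isOld w∈ eq) w≢u c′ rewrite eq with scale⁻ {P = path w} c′
        ... | r , x′ , y′ , r<N , eq₁ , eq₂ , d
          with divMod-unique D.size {q = x} {q′ = x′} z<s r<N (+-cancelˡ-≡ 2 _ _ eq₁) | *-cancelʳ-≡ y y′ N (+-cancelˡ-≡ 2 _ _ eq₂)
        ... | refl , refl | refl = others w∈ w≢u d

    attach : Representation S → Representation (L ++ S)
    attach R with Representation.own R v∈S
    ... | (hor , s , t) , c , only = attachAt R c only
    ... | (ver , s , t) , c , only = attachAt (flipped R) (flip⁺ c) (λ u∈ u≢v c′ → only u∈ u≢v (flip⁻ c′))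

-- Lists, walks and decidable reachability

module _ {A : Set} where

  unique-++⁻ʳ : ∀ xs {ys : List A} → Unique (xs ++ ys) → Unique ys
  unique-++⁻ʳ []       u       = u
  unique-++⁻ʳ (_ ∷ xs) (_ ∷ u) = unique-++⁻ʳ xs u

  unique-++⁻ˡ : ∀ xs {ys : List A} → Unique (xs ++ ys) → Unique xs
  unique-++⁻ˡ []       _       = []
  unique-++⁻ˡ (_ ∷ xs) (p ∷ u) = ++⁻ˡ xs p ∷ unique-++⁻ˡ xs u

  unique⇒lookup-injective : ∀ {xs : List A} → Unique xs → Injective _≡_ _≡_ (lookup xs)
  unique⇒lookup-injective (p ∷ u) {zero}  {zero}  _  = refl
  unique⇒lookup-injective (p ∷ u) {zero}  {suc j} eq = ⊥-elim (All.lookup p (∈-lookup j) eq)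
  unique⇒lookup-injective (p ∷ u) {suc i} {zero}  eq = ⊥-elim (All.lookup p (∈-lookup i) (sym eq))
  unique⇒lookup-injective (p ∷ u) {suc i} {suc j} eq = cong suc (unique⇒lookup-injective u eq)

  steps-++⁺ʳ : ∀ xs {ys : List A} {e} → e ∈ steps ys → e ∈ steps (xs ++ ys)
  steps-++⁺ʳ []           e∈ = e∈
  steps-++⁺ʳ (x ∷ [])     {_ ∷ _} e∈ = there e∈
  steps-++⁺ʳ (x ∷ y ∷ xs) e∈ = there (steps-++⁺ʳ (y ∷ xs) e∈)

  step-∈ : ∀ (xs : List A) {x y} → (x , y) ∈ steps xs → x ∈ xs × y ∈ xs
  step-∈ (x ∷ y ∷ xs) (here refl) = here refl , there (here refl)
  step-∈ (x ∷ y ∷ xs) (there e∈)  = let p , q = step-∈ (y ∷ xs) e∈ in there p , there q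

  traverses-∈ʳ : ∀ (xs : List A) {x y} → Traverses xs x y → y ∈ xs
  traverses-∈ʳ xs (inj₁ e∈) = proj₂ (step-∈ xs e∈)
  traverses-∈ʳ xs (inj₂ e∈) = proj₁ (step-∈ xs e∈)

  -- Converts edges of a closed cycle into positions; the closing edge is the one that starts at the
  -- last position.
  step-snoc : ∀ x xs {z : A} {p q} → (p , q) ∈ steps (x ∷ xs ++ [ z ]) →
    (∃[ i ] ∃[ j ] toℕ j ≡ suc (toℕ i) × p ≡ lookup (x ∷ xs) i × q ≡ lookup (x ∷ xs) j)
      ⊎ (p ≡ lookup (x ∷ xs) (fromℕ (length xs)) × q ≡ z)
  step-snoc x []       (here refl) = inj₂ (refl , refl)
  step-snoc x (y ∷ xs) (here refl) = inj₁ (zero , suc zero , refl , refl , refl)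
  step-snoc x (y ∷ xs) (there e∈) with step-snoc y xs e∈
  ... | inj₁ (i , j , eq , p , q) = inj₁ (suc i , suc j , cong suc eq , p , q)
  ... | inj₂ pq                   = inj₂ pq

  ∈-two-split : ∀ {x y} {xs : List A} → x ∈ xs → y ∈ xs → x ≢ y →
    (∃[ as ] ∃[ bs ] ∃[ cs ] xs ≡ as ++ x ∷ bs ++ y ∷ cs) ⊎ (∃[ as ] ∃[ bs ] ∃[ cs ] xs ≡ as ++ y ∷ bs ++ x ∷ cs)
  ∈-two-split (here refl) (here refl) x≢y = ⊥-elim (x≢y refl)
  ∈-two-split (here refl) (there y∈)  x≢y with bs , cs , refl ← ∈-∃++ y∈ = inj₁ ([] , bs , cs , refl)
  ∈-two-split (there x∈)  (here refl) x≢y with bs , cs , refl ← ∈-∃++ x∈ = inj₂ ([] , bs , cs , refl)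
  ∈-two-split (there x∈)  (there y∈)  x≢y with ∈-two-split x∈ y∈ x≢y
  ... | inj₁ (as , bs , cs , refl) = inj₁ (_ ∷ as , bs , cs , refl)
  ... | inj₂ (as , bs , cs , refl) = inj₂ (_ ∷ as , bs , cs , refl)

  -- The list holds the vertices of the walk after its first one.
  data Walk (R : Rel A 0ℓ) : A → List A → A → Set where
    []  : ∀ {x} → Walk R x [] x
    _∷_ : ∀ {x y z ys} → R x y → Walk R y ys z → Walk R x (y ∷ ys) z

  module _ {R : Rel A 0ℓ} where

    _++ʷ_ : ∀ {x y z xs ys} → Walk R x xs y → Walk R y ys z → Walk R x (xs ++ ys) z
    []      ++ʷ w = w
    (r ∷ v) ++ʷ w = r ∷ (v ++ʷ w)

    walk-prefix : ∀ {x z} ys {y zs} → Walk R x (ys ++ y ∷ zs) z → Walk R x (ys ++ [ y ]) y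
    walk-prefix []       (r ∷ _) = r ∷ []
    walk-prefix (_ ∷ ys) (r ∷ w) = r ∷ walk-prefix ys w

    walk⇒linked : ∀ {x y xs} → Walk R x xs y → Linked R (x ∷ xs)
    walk⇒linked []      = [-]
    walk⇒linked (r ∷ w) = r ∷ walk⇒linked w

    linked⇒walk : ∀ {x xs} → Linked R (x ∷ xs) → ∃[ y ] Walk R x xs y
    linked⇒walk [-]     = _ , []
    linked⇒walk (r ∷ l) = let y , w = linked⇒walk l in y , r ∷ w

    linked-++⁻ʳ : ∀ xs {ys} → Linked R (xs ++ ys) → Linked R ys
    linked-++⁻ʳ []       l       = l
    linked-++⁻ʳ (x ∷ xs) l       = linked-++⁻ʳ xs (Linked.tail l)

    linked-lookup : ∀ {xs i j} → Linked R xs → toℕ j ≡ suc (toℕ i) → R (lookup xs i) (lookup xs j)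
    linked-lookup {i = zero}  {suc zero}    (r ∷ _) refl = r
    linked-lookup {i = suc i} {suc (suc j)} (_ ∷ l) eq   = linked-lookup {i = i} {suc j} l (suc-injective eq)

    walk-last : ∀ {x y xs} → Walk R x xs y → y ≡ lookup (x ∷ xs) (fromℕ (length xs))
    walk-last []      = refl
    walk-last (_ ∷ w) = walk-last w

    walk⇒star : ∀ {x y z xs} → Walk R x xs y → z ∈ x ∷ xs → Star R x z
    walk⇒star w       (here refl) = ε
    walk⇒star (r ∷ w) (there z∈)  = r ◅ walk⇒star w z∈

    walk-All : ∀ {P : A → Set} → (∀ {x y} → R x y → P y) → ∀ {x y xs} → Walk R x xs y → All P xs
    walk-All f []      = []
    walk-All f (r ∷ w) = f r ∷ walk-All f w

  walk-map : ∀ {R T : Rel A 0ℓ} → R ⇒ T → ∀ {x y xs} → Walk R x xs y → Walk T x xs y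
  walk-map f []      = []
  walk-map f (r ∷ w) = f r ∷ walk-map f w

module _ {n : ℕ} where

  _∈ᶠ?_ : (x : Fin n) (xs : List (Fin n)) → Dec (x ∈ xs)
  _∈ᶠ?_ = member? _≟ᶠ_

  unique⇒length≤ : ∀ {xs : List (Fin n)} → Unique xs → length xs ≤ n
  unique⇒length≤ u = injective⇒≤ (unique⇒lookup-injective u)

  traverses? : ∀ xs (x y : Fin n) → Dec (Traverses xs x y)
  traverses? xs x y = any? (×-≡-dec _≟ᶠ_ _≟ᶠ_ (x , y)) (steps xs) ⊎-dec any? (×-≡-dec _≟ᶠ_ _≟ᶠ_ (y , x)) (steps xs)

  module _ {R : Rel (Fin n) 0ℓ} where

    walk-from : ∀ {x y z ys} → x ∈ y ∷ ys → Walk R y ys z → Unique (y ∷ ys) → ∃[ xs ] Walk R x xs z × Unique (x ∷ xs)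
    walk-from (here refl) w       u       = _ , w , u
    walk-from (there x∈)  (r ∷ w) (_ ∷ u) = walk-from x∈ w u

    -- Loop erasure: if the new first vertex occurs later, the walk is restarted from that
    -- occurrence.
    star⇒path : ∀ {x y} → Star R x y → ∃[ xs ] Walk R x xs y × Unique (x ∷ xs)
    star⇒path ε = [] , [] , [] ∷ []
    star⇒path {x} (r ◅ s) with star⇒path s
    ... | ys , w , u with x ∈ᶠ? (_ ∷ ys)
    ...   | yes x∈ = walk-from x∈ w u
    ...   | no x∉  = _ , r ∷ w , ¬Any⇒All¬ _ x∉ ∷ u

    -- Reachability in at most k steps is decidable by recursion on k. It is exact for k = n, since
    -- a simple path has at most n vertices.
    Reach : ℕ → Rel (Fin n) 0ℓ
    Reach zero    x y = x ≡ y
    Reach (suc k) x y = x ≡ y ⊎ (∃[ z ] R x z × Reach k z y)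

    reach⇒star : ∀ k {x y} → Reach k x y → Star R x y
    reach⇒star zero    refl               = ε
    reach⇒star (suc k) (inj₁ refl)        = ε
    reach⇒star (suc k) (inj₂ (z , r , s)) = r ◅ reach⇒star k s

    walk⇒reach : ∀ {k x y xs} → length xs ≤ k → Walk R x xs y → Reach k x y
    walk⇒reach {zero}  _       []      = refl
    walk⇒reach {suc k} _       []      = inj₁ refl
    walk⇒reach {suc k} (s≤s p) (r ∷ w) = inj₂ (_ , r , walk⇒reach p w)

    star? : Decidable R → Decidable (Star R)
    star? R? x y = map′ (reach⇒star n) complete (reach? n x y)
      where
      reach? : ∀ k → Decidable (Reach k)
      reach? zero    x y = x ≟ᶠ y
      reach? (suc k) x y = x ≟ᶠ y ⊎-dec anyᶠ? (λ z → R? x z ×-dec reach? k z y)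
      complete : Star R x y → Reach n x y
      complete s = let xs , w , u = star⇒path s in walk⇒reach (≤-trans (m≤n+m _ 1) (unique⇒length≤ u)) w

-- Cycles of a cactus have neither ears nor chords

module _ {n : ℕ} (G : Graph n) where
  open Graph G using (Adj; adj?; irrefl) renaming (sym to adj-sym)
  open SimpleCycle

  Outside : List (Fin n) → Rel (Fin n) 0ℓ
  Outside S x y = Adj x y × x ∉ S × y ∉ S

  outside? : ∀ S → Decidable (Outside S)
  outside? S x y = adj? x y ×-dec ¬? (x ∈ᶠ? S) ×-dec ¬? (y ∈ᶠ? S)

  outside-sym : ∀ {S} → Symmetric (Outside S)
  outside-sym (a , p , q) = adj-sym a , q , p

  outside-reverse : ∀ {S x y} → Star (Outside S) x y → Star (Outside S) y x
  outside-reverse = Star.reverse outside-sym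

  outside-anti : ∀ {S T} → (∀ {x} → x ∈ S → x ∈ T) → Outside T ⇒ Outside S
  outside-anti S⊆T (a , p , q) = a , p ∘ S⊆T , q ∘ S⊆T

  ∈closed⇒∈vertices : (C : SimpleCycle G) → ∀ {x} → x ∈ closed C → x ∈ vertices C
  ∈closed⇒∈vertices C x∈ with ∈-++⁻ (vertices C) x∈
  ... | inj₁ x∈C         = x∈C
  ... | inj₂ (here refl) = here refl

  module _ (cactus : ∀ C D → ¬ SameCycle G C D → ShareAtMostOneVertex G C D) where

    -- Q closes the arc of C from x to y into a cycle, which must be C itself.
    arc-closure : (C : SimpleCycle G) → ∀ as {x} bs {y} cs → vertices C ≡ as ++ x ∷ bs ++ y ∷ cs →
      ∀ {Q} → Walk Adj y (Q ++ [ x ]) x → Unique Q → (∀ {z} → z ∈ Q → z ∉ vertices C) →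
      3 ≤ length (x ∷ bs ++ y ∷ Q) → ∀ {p q} → (p , q) ∈ steps (y ∷ Q ++ [ x ]) → Traverses (closed C) p q
    arc-closure C as {x} bs {y} cs eq {Q} walk uniqueQ Q∉C len {p} {q} pq∈ =
      -- If (`p` , `q`) were not an edge of `C`, then `D` would be a different cycle sharing the two
      -- vertices `x` and `y` with it.
      decidable-stable (traverses? (closed C) p q) λ ¬pq →
        x≢y (cactus C D (λ same → ¬pq (from (same p q) (inj₁ pq∈D))) x∈C (here refl) y∈C y∈D)
      where
      eq′ : vertices C ≡ as ++ (x ∷ bs ++ [ y ]) ++ cs
      eq′ = trans eq (cong (λ l → as ++ x ∷ l) (sym (++-assoc bs [ y ] cs)))

      uniqueArc : Unique (x ∷ bs ++ [ y ])
      uniqueArc = unique-++⁻ˡ _ (unique-++⁻ʳ as (subst Unique eq′ (distinct C)))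

      arc⊆C : ∀ {z} → z ∈ x ∷ bs ++ [ y ] → z ∈ vertices C
      arc⊆C z∈ = subst (_ ∈_) (sym eq′) (∈-++⁺ʳ as (∈-++⁺ˡ z∈))

      x∈C : x ∈ vertices C
      x∈C = arc⊆C (here refl)
      y∈C : y ∈ vertices C
      y∈C = arc⊆C (there (∈-++⁺ʳ bs (here refl)))

      x≢y : x ≢ y
      x≢y with p ∷ _ ← uniqueArc = All.lookup p (∈-++⁺ʳ bs (here refl))

      arcWalk : Walk Adj x (bs ++ [ y ]) y
      arcWalk = walk-prefix bs (proj₂ (linked⇒walk (linked-++⁻ʳ as (subst (Linked Adj)
        (trans (cong (_++ [ first C ]) eq) (trans (++-assoc as _ _) (cong (λ l → as ++ x ∷ l) (++-assoc bs _ _)))) (adjacent C)))))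

      closing : (bs ++ [ y ]) ++ Q ++ [ x ] ≡ (bs ++ y ∷ Q) ++ [ x ]
      closing = trans (++-assoc bs [ y ] (Q ++ [ x ])) (sym (++-assoc bs (y ∷ Q) [ x ]))

      D : SimpleCycle G
      D = record
        { first    = x
        ; rest     = bs ++ y ∷ Q
        ; distinct = subst (λ l → Unique (x ∷ l)) (++-assoc bs [ y ] Q)
                       (Unique.++⁺ uniqueArc uniqueQ (λ (z∈ , z∈Q) → Q∉C z∈Q (arc⊆C z∈)))
        ; long     = len
        ; adjacent = subst (λ l → Linked Adj (x ∷ l)) closing (walk⇒linked (arcWalk ++ʷ walk))
        }

      y∈D : y ∈ vertices D
      y∈D = there (∈-++⁺ʳ bs (here refl))

      pq∈D : (p , q) ∈ steps (closed D)
      pq∈D = subst (λ l → (p , q) ∈ steps (x ∷ l)) (sym (++-assoc bs (y ∷ Q) [ x ])) (steps-++⁺ʳ (x ∷ bs) pq∈)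

    -- If `x` and `y` differed, a simple path extracted from the walk would close an arc of `C`. Its
    -- edges would then belong to `C`, placing an outside vertex on `C`.
    no-ear : (C : SimpleCycle G) → ∀ {x y w w′} → x ∈ vertices C → y ∈ vertices C → w ∉ vertices C → w′ ∉ vertices C →
      Star (Outside (vertices C)) w w′ → Adj x w → Adj y w′ → x ≡ y
    no-ear C {x} {y} x∈ y∈ w∉ w′∉ star xw yw′ = decidable-stable (x ≟ᶠ y) λ x≢y → ear (∈-two-split x∈ y∈ x≢y)
      where
      ordered : ∀ {as x bs y cs w w′} → vertices C ≡ as ++ x ∷ bs ++ y ∷ cs → w ∉ vertices C →
        Star (Outside (vertices C)) w w′ → Adj y w → Adj x w′ → ⊥
      ordered {as} {x} {bs} {y} {cs} {w} eq w∉ star yw xw′ with star⇒path star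
      ... | ws , walk , u = w∉ (∈closed⇒∈vertices C (traverses-∈ʳ (closed C)
              (arc-closure C as bs cs eq (yw ∷ (walk-map proj₁ walk ++ʷ (adj-sym xw′ ∷ []))) u
                (All.lookup (w∉ ∷ walk-All (proj₂ ∘ proj₂) walk)) len (here refl))))
        where
        len : 3 ≤ length (x ∷ bs ++ y ∷ w ∷ ws)
        len = s≤s (≤-trans (≤-trans (s≤s (s≤s z≤n)) (m≤n+m _ (length bs))) (≤-reflexive (sym (length-++ bs))))
      ear : _ → ⊥
      ear (inj₁ (as , bs , cs , eq)) = ordered {as} {_} {bs} eq w′∉ (outside-reverse star) yw′ xw
      ear (inj₂ (as , bs , cs , eq)) = ordered {as} {_} {bs} eq w∉ star xw yw′

    no-chord : (C : SimpleCycle G) → ∀ {x y} → x ∈ vertices C → y ∈ vertices C → Adj x y → Traverses (closed C) x y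
    no-chord C {x} {y} x∈ y∈ xy = chord (∈-two-split x∈ y∈ (λ x≡y → irrefl x≡y xy))
      where
      ordered : ∀ {as x bs y cs} → vertices C ≡ as ++ x ∷ bs ++ y ∷ cs → Adj x y → Traverses (closed C) x y
      -- With an empty arc interior the chord would close up only two vertices, but then the pair is
      -- itself a step of `C`.
      ordered {as} {x} {[]} {y} {cs} eq xy = inj₁ (subst (λ l → (x , y) ∈ steps l)
        (sym (trans (cong (_++ [ first C ]) eq) (++-assoc as _ _))) (steps-++⁺ʳ as (here refl)))
      ordered {as} {x} {b ∷ bs} {y} {cs} eq xy =
        swap (arc-closure C as (b ∷ bs) cs eq {[]} (adj-sym xy ∷ []) [] (λ ()) len (here refl))
        where
        len : 3 ≤ length (x ∷ b ∷ bs ++ [ y ])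
        len = s≤s (s≤s (≤-trans (m≤n+m 1 (length bs)) (≤-reflexive (sym (length-++ bs)))))
      chord : _ → _
      chord (inj₁ (as , bs , cs , eq)) = ordered {as} {_} {bs} eq xy
      chord (inj₂ (as , bs , cs , eq)) = swap (ordered {as} {_} {bs} eq (adj-sym xy))

    -- Growth of the represented set

    -- With the empty walk this includes that a vertex outside S has at most one neighbour in S.
    SingleAttachment : List (Fin n) → Set
    SingleAttachment S = ∀ {u u′ w w′} → u ∈ S → u′ ∈ S → w ∉ S → w′ ∉ S →
      Star (Outside S) w w′ → Adj u w → Adj u′ w′ → u ≡ u′

    record Stage (S : List (Fin n)) : Set where
      field
        unique         : Unique S
        representation : Representation G S
        attachment     : SingleAttachment S

    module _ {S : List (Fin n)} (stage : Stage S) {v w : Fin n} (v∈S : v ∈ S) (w∉S : w ∉ S) (vw : Adj v w) where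
      open Stage stage

      Return : Fin n → Set
      Return w′ = w′ ≢ w × w′ ∉ S × Adj v w′ × Star (Outside S) w w′

      return? : Dec (∃[ w′ ] Return w′)
      return? = anyᶠ? λ w′ → ¬? (w′ ≟ᶠ w) ×-dec ¬? (w′ ∈ᶠ? S) ×-dec adj? v w′ ×-dec star? (outside? S) w w′

      -- The invariant could only fail through a walk from a neighbour of `w` to a neighbour of some
      -- `u` in S. Prolonged to `w`, it forces `u` to be `v` by the old invariant, and its far end
      -- is then a `Return`.
      addPendant : ¬ (∃[ w′ ] Return w′) → Stage ([ w ] ++ S)
      addPendant ∄w′ = record
        { unique         = ¬Any⇒All¬ S w∉S ∷ unique
        ; representation = attach G v∈S inj (λ { zero → w∉S }) inner outer (gadget 0) representation
        ; attachment     = attachment′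
        }
        where
        inj : Injective _≡_ _≡_ (lookup [ w ])
        inj {zero} {zero} _ = refl

        inner : ∀ {i j} → i ≢ j → Adj (lookup [ w ] i) (lookup [ w ] j) ⇔ Consecutive (toℕ i) (toℕ j)
        inner {zero} {zero} i≢j = ⊥-elim (i≢j refl)

        outer : ∀ i {u} → u ∈ S → Adj (lookup [ w ] i) u ⇔ (u ≡ v × End i)
        outer zero u∈ = mk⇔ (λ wu → attachment u∈ v∈S w∉S w∉S ε (adj-sym wu) vw , inj₁ refl) (λ { (refl , _) → adj-sym vw })

        no-return : ∀ {u z z′} → u ∈ S → z ∉ w ∷ S → z′ ∉ w ∷ S → Star (Outside S) z z′ → Adj w z → Adj u z′ → ⊥
        no-return u∈ z∉ z′∉ star wz uz′ = ∄w′ (_ , z′∉ ∘ here , z′∉ ∘ there ,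
            subst (λ x → Adj x _) (attachment u∈ v∈S (z′∉ ∘ there) w∉S (outside-reverse star′) uz′ vw) uz′ , star′)
          where
          star′ = (wz , w∉S , z∉ ∘ there) ◅ star

        attachment′ : SingleAttachment (w ∷ S)
        attachment′ (here refl) (here refl) _  _   _    _  _    = refl
        attachment′ (here refl) (there u′∈) z∉ z′∉ star uz u′z′ =
          ⊥-elim (no-return u′∈ z∉ z′∉ (Star.map (outside-anti there) star) uz u′z′)
        attachment′ (there u∈) (here refl) z∉ z′∉ star uz u′z′ =
          ⊥-elim (no-return u∈ z′∉ z∉ (outside-reverse (Star.map (outside-anti there) star)) u′z′ uz)
        attachment′ (there u∈) (there u′∈) z∉ z′∉ star uz u′z′ =
          attachment u∈ u′∈ (z∉ ∘ there) (z′∉ ∘ there) (Star.map (outside-anti there) star) uz u′z′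

      -- The old invariant admits only `v` as a neighbour in S, and the absence of chords in `C`
      -- leaves only the adjacencies drawn by the gadget. The absence of ears carries the invariant
      -- over.
      addCycle : ∀ {w′ ws} → w′ ≢ w → Adj v w′ → Walk (Outside S) w ws w′ → Unique (w ∷ ws) → Stage ((w ∷ ws) ++ S)
      addCycle {w′} {ws} w′≢w vw′ walk uniqueL = record
        { unique         = Unique.++⁺ uniqueL unique (λ (z∈L , z∈S) → All.lookup L∉S z∈L z∈S)
        ; representation = attach G v∈S inj fresh inner outer (gadget (length ws)) representation
        ; attachment     = attachment′
        }
        where
        L : List (Fin n)
        L = w ∷ ws

        L∉S : All (_∉ S) L
        L∉S = w∉S ∷ walk-All (proj₂ ∘ proj₂) walk

        inj : Injective _≡_ _≡_ (lookup L)
        inj = unique⇒lookup-injective uniqueL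

        fresh : ∀ i → lookup L i ∉ S
        fresh i = All.lookup L∉S (∈-lookup i)

        v∉L : ∀ i → v ≢ lookup L i
        v∉L i eq = fresh i (subst (_∈ S) eq v∈S)

        last-index : Fin (length L)
        last-index = fromℕ (length ws)

        C : SimpleCycle G
        C = record
          { first    = v
          ; rest     = L
          ; distinct = All.map (λ z∉S v≡z → z∉S (subst (_∈ S) v≡z v∈S)) L∉S ∷ uniqueL
          ; long     = long′ walk
          ; adjacent = walk⇒linked (vw ∷ (walk-map proj₁ walk ++ʷ (adj-sym vw′ ∷ [])))
          }
          where
          long′ : ∀ {ws} → Walk (Outside S) w ws w′ → 3 ≤ length (v ∷ w ∷ ws)
          long′ []      = ⊥-elim (w′≢w refl)
          long′ (_ ∷ _) = s≤s (s≤s (s≤s z≤n))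

        C⊆L++S : ∀ {z} → z ∈ vertices C → z ∈ L ++ S
        C⊆L++S (here refl) = ∈-++⁺ʳ L v∈S
        C⊆L++S (there z∈)  = ∈-++⁺ˡ z∈

        step-inner : ∀ {i j} → (lookup L i , lookup L j) ∈ steps (closed C) → toℕ j ≡ suc (toℕ i)
        step-inner {i} {j} (here eq) = ⊥-elim (v∉L i (sym (cong proj₁ eq)))
        step-inner {i} {j} (there ij∈) with step-snoc w ws ij∈
        ... | inj₁ (i′ , j′ , eq , p , q) = trans (cong toℕ (inj q)) (trans eq (cong (suc ∘ toℕ) (sym (inj p))))
        ... | inj₂ (_ , q)                = ⊥-elim (v∉L j (sym q))

        inner : ∀ {i j} → i ≢ j → Adj (lookup L i) (lookup L j) ⇔ Consecutive (toℕ i) (toℕ j)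
        inner {i} {j} _ = mk⇔ consecutive linked
          where
          consecutive : Adj (lookup L i) (lookup L j) → Consecutive (toℕ i) (toℕ j)
          consecutive ij with no-chord C (there (∈-lookup i)) (there (∈-lookup j)) ij
          ... | inj₁ ij∈ = inj₁ (step-inner ij∈)
          ... | inj₂ ji∈ = inj₂ (step-inner ji∈)
          linked : Consecutive (toℕ i) (toℕ j) → Adj (lookup L i) (lookup L j)
          linked (inj₁ eq) = proj₁ (linked-lookup {i = i} {j} (walk⇒linked walk) eq)
          linked (inj₂ eq) = adj-sym (proj₁ (linked-lookup {i = j} {i} (walk⇒linked walk) eq))

        end : ∀ i → Traverses (closed C) (lookup L i) v → End i
        end i (inj₁ (here eq)) = ⊥-elim (v∉L i (sym (cong proj₁ eq)))
        end i (inj₁ (there iv∈)) with step-snoc w ws iv∈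
        ... | inj₁ (_ , j , _ , _ , q) = ⊥-elim (v∉L j q)
        ... | inj₂ (p , _)             = inj₂ (cong suc (trans (cong toℕ (inj p)) (toℕ-fromℕ (length ws))))
        end i (inj₂ (here eq)) = inj₁ (cong toℕ (inj {i} {zero} (cong proj₂ eq)))
        end i (inj₂ (there vi∈)) with step-snoc w ws vi∈
        ... | inj₁ (j , _ , _ , p , _) = ⊥-elim (v∉L j p)
        ... | inj₂ (p , _)             = ⊥-elim (v∉L last-index p)

        end-adjacent : ∀ i → End i → Adj (lookup L i) v
        end-adjacent i (inj₁ eq) with refl ← toℕ-injective {j = zero} eq = adj-sym vw
        end-adjacent i (inj₂ eq)
          with refl ← toℕ-injective {i = i} {j = last-index} (trans (suc-injective eq) (sym (toℕ-fromℕ (length ws)))) =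
          adj-sym (subst (Adj v) (walk-last walk) vw′)

        root : ∀ {u z} → u ∈ S → z ∉ S → Star (Outside S) w z → Adj u z → u ≡ v
        root u∈ z∉ star uz = attachment u∈ v∈S z∉ w∉S (outside-reverse star) uz vw

        outer : ∀ i {u} → u ∈ S → Adj (lookup L i) u ⇔ (u ≡ v × End i)
        outer i {u} u∈ = mk⇔ only-root (λ { (refl , e) → end-adjacent i e })
          where
          only-root : Adj (lookup L i) u → u ≡ v × End i
          only-root iu with refl ← root u∈ (fresh i) (walk⇒star walk (∈-lookup i)) (adj-sym iu) =
            refl , end i (no-chord C (there (∈-lookup i)) (here refl) iu)

        attachment′ : SingleAttachment (L ++ S)
        attachment′ {u} {u′} {z} {z′} u∈ u′∈ z∉ z′∉ star uz u′z′ = cases (∈-++⁻ L u∈) (∈-++⁻ L u′∈)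
          where
          z∉S : z ∉ S
          z∉S = z∉ ∘ ∈-++⁺ʳ L
          z′∉S : z′ ∉ S
          z′∉S = z′∉ ∘ ∈-++⁺ʳ L
          starS : Star (Outside S) z z′
          starS = Star.map (outside-anti (∈-++⁺ʳ L)) star
          on-cycle : u ∈ vertices C → u′ ∈ vertices C → u ≡ u′
          on-cycle u∈C u′∈C = no-ear C u∈C u′∈C (z∉ ∘ C⊆L++S) (z′∉ ∘ C⊆L++S) (Star.map (outside-anti C⊆L++S) star) uz u′z′
          reach : ∀ {x y} → x ∈ L → y ∉ S → Adj x y → Star (Outside S) w y
          reach x∈L y∉S xy = walk⇒star walk x∈L ◅◅ ((xy , All.lookup L∉S x∈L , y∉S) ◅ ε)
          cases : u ∈ L ⊎ u ∈ S → u′ ∈ L ⊎ u′ ∈ S → u ≡ u′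
          cases (inj₁ u∈L) (inj₁ u′∈L) = on-cycle (there u∈L) (there u′∈L)
          -- Via the new vertices, `w` reaches `z′` outside S, so `u′` is `v` and lies on `C` too;
          -- `no-ear` then applies.
          cases (inj₁ u∈L) (inj₂ u′∈S) = on-cycle (there u∈L)
            (here (root u′∈S z′∉S (reach u∈L z∉S uz ◅◅ starS) u′z′))
          cases (inj₂ u∈S) (inj₁ u′∈L) = on-cycle
            (here (root u∈S z∉S (reach u′∈L z′∉S u′z′ ◅◅ outside-reverse starS) uz)) (there u′∈L)
          cases (inj₂ u∈S) (inj₂ u′∈S) = attachment u∈S u′∈S z∉S z′∉S starS uz u′z′

      extend : ∃[ ws ] Stage ((w ∷ ws) ++ S)
      extend with return?
      ... | no ∄w′ = [] , addPendant ∄w′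
      ... | yes (w′ , w′≢w , _ , vw′ , star) = let ws , walk , u = star⇒path star in ws , addCycle w′≢w vw′ walk u

    crossing : ∀ {S x z} → Star Adj x z → x ∈ S → z ∉ S → ∃[ v ] ∃[ w ] v ∈ S × w ∉ S × Adj v w
    crossing ε x∈ z∉ = ⊥-elim (z∉ x∈)
    crossing {S} (_◅_ {j = y} xy star) x∈ z∉ with y ∈ᶠ? S
    ... | yes y∈ = crossing star y∈ z∉
    ... | no y∉  = _ , _ , x∈ , y∉ , xy

    -- `k` bounds the number of missing vertices and serves as fuel: each extension adds at least
    -- one. At zero, a missing vertex would give more than n distinct ones.
    complete : Connected G → ∀ k {S r} → r ∈ S → n ≤ k + length S → Stage S → ∃[ T ] Representation G T × (∀ x → x ∈ T)
    complete conn k {S} {r} r∈ n≤ stage with anyᶠ? (λ z → ¬? (z ∈ᶠ? S))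
    ... | no ∄z = S , Stage.representation stage , λ x → decidable-stable (x ∈ᶠ? S) (λ x∉ → ∄z (x , x∉))
    complete conn zero {S} r∈ n≤ stage | yes (z , z∉) =
      ⊥-elim (1+n≰n (≤-trans (unique⇒length≤ (¬Any⇒All¬ S z∉ ∷ Stage.unique stage)) n≤))
    complete conn (suc k) {S} {r} r∈ n≤ stage | yes (z , z∉)
      with v , w , v∈ , w∉ , vw ← crossing (conn r z) r∈ z∉
      with ws , stage′ ← extend stage v∈ w∉ vw =
      complete conn k (∈-++⁺ʳ (w ∷ ws) r∈) (≤-trans n≤ bound) stage′
      where
      bound : suc k + length S ≤ k + length ((w ∷ ws) ++ S)
      bound = ≤-trans (≤-reflexive (sym (+-suc k (length S))))
        (+-monoʳ-≤ k (s≤s (≤-trans (m≤n+m _ (length ws)) (≤-reflexive (sym (length-++ ws))))))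

    singleton : ∀ r → Stage [ r ]
    singleton r = record
      { unique         = [] ∷ []
      ; representation = record
          -- A single unit edge; the values away from `r` are arbitrary.
          { path  = λ _ → bent hor 0 0 1 0 z≤n z≤n
          ; share = λ { (here refl) (here refl) u≢v → ⊥-elim (u≢v refl) }
          ; own   = λ { (here refl) → (hor , 0 , 0) , leg₁ z≤n (s≤s z≤n) , λ { (here refl) u≢v → ⊥-elim (u≢v refl) } }
          }
      ; attachment     = λ { (here refl) (here refl) _ _ _ _ _ → refl }
      }

  -- A common grid for all paths

  bounded : ∀ {m} (f : Fin m → ℕ) → ∃[ B ] (∀ i → f i ≤ B)
  bounded {zero}  f = 0 , λ ()
  bounded {suc m} f = let B , le = bounded (f ∘ suc) in
    f zero ⊔ B , λ { zero → m≤m⊔n _ _ ; (suc i) → ≤-trans (le i) (m≤n⊔m (f zero) B) }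

  representation⇒B₁ᵐ : ∀ {T} → Representation G T → (∀ x → x ∈ T) → B₁ᵐ G
  representation⇒B₁ᵐ R all = record
    { cols      = suc B
    ; rows      = suc B
    ; path      = λ v → realise (path v) (le′ v)
    ; adj⇔share = λ {u} {v} u≢v → mk⇔
        (λ uv → share⇒shareEdge (path u) (path v) (le′ u) (le′ v) (to (share (all u) (all v) u≢v) uv))
        (λ sh → from (share (all u) (all v) u≢v) (shareEdge⇒share (path u) (path v) (le′ u) (le′ v) sh))
    } , λ v → realise-monotonic (path v) (le′ v) , realise-atMostOneBend (path v) (le′ v)
    where
    open Representation R
    B   = proj₁ (bounded (extent ∘ path))
    le′ = proj₂ (bounded (extent ∘ path))

theorem5p9 : ∀ (n : ℕ) (G : Graph n) → IsCactus G → B₁ᵐ G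
-- The empty graph satisfies the definition of a cactus but offers no vertex to start from.
theorem5p9 zero G _ = representation⇒B₁ᵐ G {[]} (record { path = λ () ; share = λ () ; own = λ () }) λ ()
theorem5p9 (suc n) G (conn , cactus) =
  let T , R , all = complete G cactus conn (suc n) {r = zero} (here refl) (m≤m+n _ 1) (singleton G cactus zero)
  in representation⇒B₁ᵐ G R all
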